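{- $\mathscr{I}(W_5) \le \frac{1019}{3888}$.
   Context: All graphs are finite and simple. $W_{5}$ denotes the $5$-wheel, the join of the cycle $C_{5}$ with a single vertex $K_1$ (so $W_5$ has $6$ vertices). The Cartesian product $G \Box H$ has vertex set $V(G)\times V(H)$, with $(u,x)$ adjacent to $(v,y)$ if and only if either $u=v$ and $xy\in E(H)$, or $x=y$ and $uv\in E(G)$. Set $G^{\Box 1}=G$ and $G^{\Box k}=G^{\Box (k-1)}\Box G$ for $k\ge 2$. $\alpha(G)$ is the independence number of $G$. The independence ratio is $i(G)=\alpha(G)/|V(G)|$, and the ultimate independence ratio is $\mathscr{I}(G)=\lim_{m\to\infty} i(G^{\Box m})$; this limit exists because $i(G^{\Box (m+1)})\le i(G^{\Box m})$ for all $m$. -}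

module Defs where

open import Data.Bool.Base using (Bool; true; false; if_then_else_)
open import Data.Empty using (⊥; ⊥-elim)
open import Data.Fin.Base using (Fin; zero; suc; toℕ; combine; _↑ˡ_; _↑ʳ_)
import Data.Fin.Properties as Fin
open import Data.Fin.Subset as Subset using (Subset; _∈_; ∣_∣)
open import Data.Fin.Subset.Properties using (_∈?_; anySubset?; ∣p∣≤n; ∣⊥∣≡0; ∉⊥)
import Data.Integer.Base as ℤ
import Data.Integer.Properties as ℤ
open import Data.Nat.Base as ℕ using (ℕ; zero; suc; _+_; _*_; _%_; NonZero)
import Data.Nat.Properties as ℕ
open import Data.Product using (∃; _×_; _,_; proj₁; proj₂)
open import Data.Product.Function.NonDependent.Propositional using (_×-↔_)
open import Data.Rational.Base as ℚ using (ℚ; 0ℚ; 1ℚ; _/_; _<_; _≤_)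
import Data.Rational.Properties as ℚ
import Data.Rational.Unnormalised.Base as ℚᵘ
import Data.Rational.Unnormalised.Properties as ℚᵘ
open import Data.Sum.Base using (_⊎_; inj₁; inj₂)
open import Data.Sum.Function.Propositional using (_⊎-↔_)
open import Data.Unit.Base using (⊤; tt)
open import Data.Vec.Base using ([]; _∷_; lookup; tabulate)
open import Data.Vec.Properties using (lookup∘tabulate; []=⇒lookup; lookup⇒[]=)
open import Function.Base using (_∘_; id)
open import Function.Bundles using (_↔_; Inverse)
open import Function.Construct.Identity using (↔-id)
open import Function.Construct.Composition using (_↔-∘_)
open import Function.Construct.Symmetry using (↔-sym)
open import Function.Properties.Inverse using (↔⇒↣)
open import Level using (0ℓ)
open import Relation.Binary.Core using (Rel)
open import Relation.Binary.Definitions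
  using (Symmetric; Irreflexive; Decidable; DecidableEquality)
open import Relation.Binary.PropositionalEquality
  using (_≡_; refl; sym; trans; cong; subst; subst₂)
open import Relation.Nullary using (¬_; Dec; yes; no)
open import Relation.Nullary.Decidable
  using (_×-dec_; _⊎-dec_; _→-dec_; ¬?; via-injection; from-yes; map′)
open import Relation.Unary using (Pred)

open import Algebra.Properties.CommutativeMonoid.Sum ℕ.+-0-commutativeMonoid
  using (sum; sum-cong-≗; ∑-comm)

record Graph : Set₁ where
  infix 4 _~_ _~?_
  field
    V           : Set
    order       : ℕ
    enumeration : V ↔ Fin order
    _~_         : Rel V 0ℓ
    ~-sym       : Symmetric _~_
    ~-irrefl    : Irreflexive _≡_ _~_
    _~?_        : Decidable _~_

  index : V → Fin order
  index = Inverse.to enumeration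

  vertex : Fin order → V
  vertex = Inverse.from enumeration

  _≟_ : DecidableEquality V
  _≟_ = via-injection (↔⇒↣ enumeration) Fin._≟_

open Graph using (order)

K₁ : Graph
K₁ = record
  { V           = Fin 1
  ; order       = 1
  ; enumeration = ↔-id _
  ; _~_         = λ _ _ → ⊥
  ; ~-sym       = λ ()
  ; ~-irrefl    = λ _ ()
  ; _~?_        = λ _ _ → no λ ()
  }

C₅ : Graph
C₅ = record
  { V           = Fin 5
  ; order       = 5
  ; enumeration = ↔-id _
  ; _~_         = Adj
  ; ~-sym       = λ { (inj₁ p) → inj₂ p ; (inj₂ p) → inj₁ p }
  ; ~-irrefl    = λ { {u} refl → from-yes (Fin.all? (λ v → ¬? (adj? v v))) u }
  ; _~?_        = adj?
  }
  where
  Adj : Rel (Fin 5) 0ℓ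
  Adj u v = toℕ v ≡ suc (toℕ u) % 5 ⊎ toℕ u ≡ suc (toℕ v) % 5

  adj? : Decidable Adj
  adj? u v = (toℕ v ℕ.≟ suc (toℕ u) % 5) ⊎-dec (toℕ u ℕ.≟ suc (toℕ v) % 5)

infixr 6 _∨ᴳ_

_∨ᴳ_ : Graph → Graph → Graph
G ∨ᴳ H = record
  { V           = G.V ⊎ H.V
  ; order       = G.order + H.order
  ; enumeration = ↔-sym Fin.+↔⊎ ↔-∘ (G.enumeration ⊎-↔ H.enumeration)
  ; _~_         = Adj
  ; ~-sym       = λ {u} {v} → adj-sym u v
  ; ~-irrefl    = λ { {inj₁ u} refl → G.~-irrefl refl
                    ; {inj₂ x} refl → H.~-irrefl refl }
  ; _~?_        = adj?
  }
  where
  module G = Graph G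
  module H = Graph H

  Adj : Rel (G.V ⊎ H.V) 0ℓ
  Adj (inj₁ u) (inj₁ v) = u G.~ v
  Adj (inj₂ x) (inj₂ y) = x H.~ y
  Adj (inj₁ _) (inj₂ _) = ⊤
  Adj (inj₂ _) (inj₁ _) = ⊤

  adj-sym : ∀ u v → Adj u v → Adj v u
  adj-sym (inj₁ _) (inj₁ _) = G.~-sym
  adj-sym (inj₂ _) (inj₂ _) = H.~-sym
  adj-sym (inj₁ _) (inj₂ _) = id
  adj-sym (inj₂ _) (inj₁ _) = id

  adj? : Decidable Adj
  adj? (inj₁ u) (inj₁ v) = u G.~? v
  adj? (inj₂ x) (inj₂ y) = x H.~? y
  adj? (inj₁ _) (inj₂ _) = yes tt
  adj? (inj₂ _) (inj₁ _) = yes tt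

W₅ : Graph
W₅ = C₅ ∨ᴳ K₁

infixl 7 _□_

_□_ : Graph → Graph → Graph
G □ H = record
  { V           = G.V × H.V
  ; order       = G.order * H.order
  ; enumeration = ↔-sym Fin.*↔× ↔-∘ (G.enumeration ×-↔ H.enumeration)
  ; _~_         = Adj
  ; ~-sym       = λ { (inj₁ (p , e)) → inj₁ (sym p , H.~-sym e)
                    ; (inj₂ (p , e)) → inj₂ (sym p , G.~-sym e) }
  ; ~-irrefl    = λ { refl (inj₁ (_ , e)) → H.~-irrefl refl e
                    ; refl (inj₂ (_ , e)) → G.~-irrefl refl e }
  ; _~?_        = λ { (u , x) (v , y) →
                      ((u G.≟ v) ×-dec (x H.~? y)) ⊎-dec
                      ((x H.≟ y) ×-dec (u G.~? v)) }
  }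
  where
  module G = Graph G
  module H = Graph H

  Adj : Rel (G.V × H.V) 0ℓ
  Adj (u , x) (v , y) = (u ≡ v × x H.~ y) ⊎ (x ≡ y × u G.~ v)

infix 8 _^□_

_^□_ : Graph → (k : ℕ) → .{{NonZero k}} → Graph
G ^□ suc zero      = G
G ^□ suc k@(suc _) = (G ^□ k) □ G

^□-nonZero : ∀ G .{{_ : NonZero (order G)}} k .{{_ : NonZero k}} →
             NonZero (order (G ^□ k))
^□-nonZero G (suc zero)      = ℕ.≢-nonZero (ℕ.≢-nonZero⁻¹ _)
^□-nonZero G (suc k@(suc _)) =
  ℕ.m*n≢0 (order (G ^□ k)) (order G) {{^□-nonZero G k}}

-- A set of vertices is given by the set of their indices.
Independent : (G : Graph) → Pred (Subset (order G)) 0ℓ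
Independent G S = ∀ u v → index u ∈ S → index v ∈ S → ¬ (u ~ v)
  where open Graph G

private
  independent? : ∀ G S → Dec (Independent G S)
  independent? G S = map′ to from
    (Fin.all? λ i → Fin.all? λ j →
      (i ∈? S) →-dec ((j ∈? S) →-dec ¬? (vertex i ~? vertex j)))
    where
    open Graph G
    open Inverse enumeration using (strictlyInverseˡ; strictlyInverseʳ)

    to : (∀ i j → i ∈ S → j ∈ S → ¬ (vertex i ~ vertex j)) → Independent G S
    to f u v u∈S v∈S u~v = f (index u) (index v) u∈S v∈S
      (subst₂ _~_ (sym (strictlyInverseʳ u)) (sym (strictlyInverseʳ v)) u~v)

    from : Independent G S → ∀ i j → i ∈ S → j ∈ S → ¬ (vertex i ~ vertex j)
    from ind i j i∈S j∈S = ind (vertex i) (vertex j)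
      (subst (_∈ S) (sym (strictlyInverseˡ i)) i∈S)
      (subst (_∈ S) (sym (strictlyInverseˡ j)) j∈S)

  greatest : (P : Pred ℕ 0ℓ) → (∀ k → Dec (P k)) → P 0 → ∀ n →
             ∃ λ k → P k × (∀ j → j ℕ.≤ n → P j → j ℕ.≤ k)
  greatest P P? p₀ zero    = 0 , p₀ , λ _ j≤0 _ → j≤0
  greatest P P? p₀ (suc n) with P? (suc n)
  ... | yes p = suc n , p , λ _ j≤n _ → j≤n
  ... | no ¬p with k , pk , k-max ← greatest P P? p₀ n =
    k , pk , λ j j≤1+n pj →
      k-max j (ℕ.≤-pred (ℕ.≤∧≢⇒< j≤1+n λ { refl → ¬p pj })) pj

-- Opaque only to stop its search over all subsets from being unfolded; the
-- type determines the size of the set.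
opaque
  maximumIndependent : ∀ G → ∃ λ S →
    Independent G S × (∀ T → Independent G T → ∣ T ∣ ℕ.≤ ∣ S ∣)
  maximumIndependent G =
    let _ , (S , ind , eq) , k-max = greatest HasSize hasSize? empty (order G)
    in S , ind , λ T indT → subst (∣ T ∣ ℕ.≤_) (sym eq)
                              (k-max ∣ T ∣ (∣p∣≤n T) (T , indT , refl))
    where
    HasSize : Pred ℕ 0ℓ
    HasSize k = ∃ λ S → Independent G S × ∣ S ∣ ≡ k

    hasSize? : ∀ k → Dec (HasSize k)
    hasSize? k = anySubset? λ S → independent? G S ×-dec (∣ S ∣ ℕ.≟ k)

    empty : HasSize 0
    empty = Subset.⊥ , (λ _ _ u∈⊥ → ⊥-elim (∉⊥ u∈⊥)) , ∣⊥∣≡0 (order G)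

α : Graph → ℕ
α G = ∣ proj₁ (maximumIndependent G) ∣

i : (G : Graph) → .{{NonZero (order G)}} → ℚ
i G = ℤ.+ α G / order G

-- A real x is given by its open upper set { q ∈ ℚ ∣ x < q }. Classically
-- these are exactly the Dedekind reals. Locatedness is not required: with
-- it, a bounded monotone sequence need not have a limit constructively.
record ℝ : Set₁ where
  field
    Above     : Pred ℚ 0ℓ
    inhabited : ∃ Above
    bounded   : ∃ λ q → ¬ Above q
    upward    : ∀ {q r} → q < r → Above q → Above r
    open-     : ∀ {q} → Above q → ∃ λ r → r < q × Above r

  Below : Pred ℚ 0ℓ
  Below q = ∃ λ r → q < r × ¬ Above r

open ℝ using (Above; Below)

infix 4 _≤ℝ_ _⟶_

_≤ℝ_ : ℝ → ℝ → Set
x ≤ℝ y = ∀ q → Above y q → Above x q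

private
  q<q+1 : ∀ q → q < q ℚ.+ 1ℚ
  q<q+1 q = subst (_< q ℚ.+ 1ℚ) (ℚ.+-identityʳ q)
              (ℚ.+-monoʳ-< q (ℚ.positive⁻¹ 1ℚ))

fromℚ : ℚ → ℝ
fromℚ p = record
  { Above     = p <_
  ; inhabited = p ℚ.+ 1ℚ , q<q+1 p
  ; bounded   = p , ℚ.<-irrefl refl
  ; upward    = λ q<r p<q → ℚ.<-trans p<q q<r
  ; open-     = λ p<q → let m , p<m , m<q = ℚ.<-dense p<q in m , m<q , p<m
  }

Eventually : Pred ℕ 0ℓ → Set
Eventually P = ∃ λ N → ∀ n → N ℕ.≤ n → P n

-- Convergence in the order topology: a is eventually in every rational
-- open interval around x.
_⟶_ : (ℕ → ℚ) → ℝ → Set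
a ⟶ x = (∀ q → Above x q → Eventually λ n → a n < q)
      × (∀ q → Below x q → Eventually λ n → q < a n)

limit-unique : ∀ {a x y} → a ⟶ x → a ⟶ y → ∀ {q} → Above x q → ¬ ¬ Above y q
limit-unique {x = x} (a<x , _) (_ , y<a) {q} x<q ¬y<q =
  let r , r<q , x<r = ℝ.open- x x<q
      M , f = a<x r x<r
      N , g = y<a r (q , r<q , ¬y<q)
  in ℚ.<-asym (f (M ℕ.⊔ N) (ℕ.m≤m⊔n M N)) (g (M ℕ.⊔ N) (ℕ.m≤n⊔m M N))

antitone-converges : (a : ℕ → ℚ) → (∀ n → a (suc n) ≤ a n) →
                     ∀ l → (∀ n → l ≤ a n) → ∃ (a ⟶_)
antitone-converges a step l l≤a = L , above , below
  where
  anti : ∀ {m n} → m ℕ.≤′ n → a n ≤ a m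
  anti (ℕ.≤′-reflexive refl) = ℚ.≤-refl
  anti (ℕ.≤′-step m≤n)       = ℚ.≤-trans (step _) (anti m≤n)

  L : ℝ
  L = record
    { Above     = λ q → ∃ λ m → a m < q
    ; inhabited = a 0 ℚ.+ 1ℚ , 0 , q<q+1 (a 0)
    ; bounded   = l , λ (m , am<l) → ℚ.<-irrefl refl (ℚ.<-≤-trans am<l (l≤a m))
    ; upward    = λ q<r (m , am<q) → m , ℚ.<-trans am<q q<r
    ; open-     = λ (m , am<q) →
        let r , am<r , r<q = ℚ.<-dense am<q in r , r<q , m , am<r
    }

  above : ∀ q → Above L q → Eventually λ n → a n < q
  above q (m , am<q) = m , λ n m≤n → ℚ.≤-<-trans (anti (ℕ.≤⇒≤′ m≤n)) am<q

  below : ∀ q → Below L q → Eventually λ n → q < a n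
  below q (r , q<r , ¬Lr) = 0 , λ n _ →
    ℚ.<-≤-trans q<r (ℚ.≮⇒≥ λ an<r → ¬Lr (n , an<r))

bit : Bool → ℕ
bit b = if b then 1 else 0

∣∣≡sum : ∀ {n} (S : Subset n) → ∣ S ∣ ≡ sum (bit ∘ lookup S)
∣∣≡sum []          = refl
∣∣≡sum (true  ∷ S) = cong suc (∣∣≡sum S)
∣∣≡sum (false ∷ S) = ∣∣≡sum S

sum-split : ∀ m {n} (f : Fin (m + n) → ℕ) →
            sum f ≡ sum (f ∘ (_↑ˡ n)) + sum (f ∘ (m ↑ʳ_))
sum-split zero    f = refl
sum-split (suc m) f =
  trans (cong (f zero +_) (sum-split m (f ∘ suc))) (sym (ℕ.+-assoc (f zero) _ _))

sum-combine : ∀ m {n} (f : Fin (m * n) → ℕ) →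
              sum f ≡ sum (λ x → sum (λ y → f (combine {m} {n} x y)))
sum-combine zero        f = refl
sum-combine (suc m) {n} f =
  trans (sum-split n f) (cong (sum (f ∘ (_↑ˡ (m * n))) +_) (sum-combine m (f ∘ (n ↑ʳ_))))

sum-bounded : ∀ n (f : Fin n → ℕ) c → (∀ x → f x ℕ.≤ c) → sum f ℕ.≤ n * c
sum-bounded zero    f c f≤c = ℕ.z≤n
sum-bounded (suc n) f c f≤c = ℕ.+-mono-≤ (f≤c zero) (sum-bounded n (f ∘ suc) c (f≤c ∘ suc))

module _ (G H : Graph) where
  private
    module G  = Graph G
    module H  = Graph H

  fibre : Subset (order (G □ H)) → Fin H.order → Subset G.order
  fibre S y = tabulate λ x → lookup S (combine x y)

  ∣∣≡∑fibre : ∀ S → ∣ S ∣ ≡ sum (λ y → ∣ fibre S y ∣)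
  ∣∣≡∑fibre S = trans (∣∣≡sum S) (trans (sum-combine G.order _)
    (trans (∑-comm {G.order} {H.order} λ x y → bit (lookup S (combine x y)))
      (sum-cong-≗ {H.order} λ y → sym (trans (∣∣≡sum (fibre S y))
        (sum-cong-≗ {G.order} λ x → cong bit (lookup∘tabulate (λ x → lookup S (combine x y)) x))))))

  fibre-independent : ∀ S → Independent (G □ H) S →
                      ∀ y → Independent G (fibre S y)
  fibre-independent S ind y u v u∈ v∈ u~v =
    ind (u , H.vertex y) (v , H.vertex y) (lift u u∈) (lift v v∈) (inj₂ (refl , u~v))
    where
    lift : ∀ w → G.index w ∈ fibre S y →
           combine (G.index w) (H.index (H.vertex y)) ∈ S
    lift w w∈ rewrite Inverse.strictlyInverseˡ H.enumeration y =
      lookup⇒[]= _ S (trans (sym (lookup∘tabulate _ (G.index w))) ([]=⇒lookup w∈))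

  α-□ : α (G □ H) ℕ.≤ H.order * α G
  α-□ =
    let S , ind , _ = maximumIndependent (G □ H)
        _ , _ , max = maximumIndependent G
    in ℕ.≤-trans (ℕ.≤-reflexive (∣∣≡∑fibre S)) (sum-bounded H.order _ (α G) λ y →
         max (fibre S y) (fibre-independent S ind y))

/-mono : ∀ a b c d .{{_ : NonZero b}} .{{_ : NonZero d}} →
         a * d ℕ.≤ c * b → ℤ.+ a / b ≤ ℤ.+ c / d
/-mono a b@(suc _) c d@(suc _) ad≤cb = ℚ.toℚᵘ-cancel-≤
  (ℚᵘ.≤-respˡ-≃ (ℚᵘ.≃-sym (ℚ.toℚᵘ-fromℚᵘ (ℤ.+ a ℚᵘ./ b)))
  (ℚᵘ.≤-respʳ-≃ (ℚᵘ.≃-sym (ℚ.toℚᵘ-fromℚᵘ (ℤ.+ c ℚᵘ./ d)))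
  (ℚᵘ.*≤* (subst₂ ℤ._≤_ (ℤ.pos-* a d) (ℤ.pos-* c b) (ℤ.+≤+ ad≤cb)))))

i-□ : ∀ G H .{{_ : NonZero (order G)}} .{{_ : NonZero (order (G □ H))}} →
      i (G □ H) ≤ i G
i-□ G H = /-mono (α (G □ H)) (order (G □ H)) (α G) (order G) (begin
  α (G □ H) * order G         ≤⟨ ℕ.*-monoˡ-≤ (order G) (α-□ G H) ⟩
  order H * α G * order G     ≡⟨ cong (_* order G) (ℕ.*-comm (order H) (α G)) ⟩
  α G * order H * order G     ≡⟨ ℕ.*-assoc (α G) (order H) (order G) ⟩
  α G * (order H * order G)   ≡⟨ cong (α G *_) (ℕ.*-comm (order H) (order G)) ⟩
  α G * (order G * order H)   ∎)
  where open ℕ.≤-Reasoning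

module _ (G : Graph) .{{_ : NonZero (order G)}} where

  ratio : ℕ → ℚ
  ratio m = i (G ^□ suc m) {{^□-nonZero G (suc m)}}

  ratio-converges : ∃ (ratio ⟶_)
  ratio-converges = antitone-converges ratio
    (λ m → i-□ (G ^□ suc m) G {{^□-nonZero G (suc m)}} {{^□-nonZero G (suc (suc m))}})
    0ℚ
    (λ m → /-mono 0 1 (α (G ^□ suc m)) (order (G ^□ suc m)) {{_}} {{^□-nonZero G (suc m)}} ℕ.z≤n)

  -- The limit of i (G ^□ k); ratio m is the term for the power k = m + 1.
  𝓘 : ℝ
  𝓘 = proj₁ ratio-converges

-- The ratios decrease, so it suffices to bound one of them. The weights ω on the 216 vertices of
-- Cube = W₅ □ W₅ □ W₅ have sum 1444, and no independent set of Cube has weight above 378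
-- (cube-bound). For a vertex x of the power 1 + 3n let Z x be the sum of the weights of its last
-- n blocks of three coordinates. The average of Z over all vertices, counted only on an
-- independent set, is at most 378 n / 216, whereas by Chebyshev's inequality Z is close to its
-- mean 1444 n / 216 at almost all vertices. Hence the independence ratio is at most
-- 378 / 1444 + o(1), and 378 / 1444 < 1019 / 3888.
--
-- To prove cube-bound, cut an independent set of Cube along its first coordinate into a hub slice
-- H and five rim slices. They are independent in W₅ □ W₅, the rim slices avoid H, and cyclically
-- consecutive ones are disjoint. By symmetry H may be taken with minimal code among its images
-- under the automorphisms of W₅ □ W₅ that permute the rims; for each of the 208 such H of
-- sufficient weight an exhaustive search excludes rim slices of large total weight. It stays
-- small because each vertex lies in at most two rim slices, which is used to lower the weights in
-- advance (reduced), and because it starts from the heaviest pair of consecutive slices.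
module Submission where

open import Defs

open import Data.Bool.Base using (Bool; true; false; T; _∧_; _∨_; not; if_then_else_)
open import Data.Bool.ListAction using (all)
open import Data.Bool.Properties using (T-∧; T-∨; T-≡)
open import Data.Empty using (⊥; ⊥-elim)
open import Data.Fin.Base using (Fin; zero; suc)
open import Data.Fin.Patterns using (0F; 1F; 2F; 3F; 4F)
open import Data.Fin.Properties using (remQuot-combine)
open import Data.Fin.Subset using (Subset; ∣_∣)
import Data.Integer.Base as ℤ
open import Data.List.Base using (List; []; _∷_; concatMap; map; filterᵇ)
open import Data.List.Extrema.Nat using (argmax; argmax-all; f[xs]≤f[argmax]; f[⊥]≤f[argmax])
open import Data.List.Membership.Propositional using (_∈_; lose)
open import Data.List.Membership.Propositional.Properties using (∈-concatMap⁺; ∈-filter⁺)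
open import Data.List.Relation.Unary.All as All using (All; []; _∷_)
open import Data.List.Relation.Unary.All.Properties using (all⁺; all⁻)
open import Data.List.Relation.Unary.Any using (here; there)
open import Data.Nat.Base renaming (_/_ to _div_)
open import Data.Nat.DivMod using (m<n*o⇒m/o<n)
open import Data.Nat.Induction using (<-wellFounded)
open import Data.Nat.Properties
open import Data.Nat.Tactic.RingSolver using (solve-∀)
open import Data.Product.Base using (_×_; _,_; proj₁; proj₂; ∃)
import Data.Rational.Base as ℚ
import Data.Rational.Properties as ℚ
open import Data.Sum.Base using (_⊎_; inj₁; inj₂; [_,_]′; map₁)
open import Data.Unit.Base using (tt)
open import Data.Vec.Base using (Vec; []; _∷_; lookup)
open import Data.Vec.Properties using (lookup⇒[]=)
open import Function.Base using (_∘_; id)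
open import Function.Bundles using (Inverse; module Equivalence)
open import Induction.WellFounded using (Acc; acc)
open import Relation.Binary.PropositionalEquality
  using (_≡_; refl; sym; trans; cong; cong₂; subst; module ≡-Reasoning)
open import Relation.Nullary.Decidable.Core using (T?)
open import Relation.Nullary.Negation.Core using (¬_)

open import Algebra.Properties.CommutativeMonoid.Sum +-0-commutativeMonoid
  using (sum; sum-cong-≗; ∑-comm; ∑-distrib-+)
open import Algebra.Properties.Semiring.Sum +-*-semiring using (*-distribˡ-sum)

open Graph using (order)

private
  variable
    A : Set

-- Independent sets of `W₅`

data Pt : Set where
  v0 v1 v2 v3 v4 hub : Pt

-- The independent sets of W₅: ★ is the hub, aᵢ = {i} and bᵢ = {i , i + 2} on the rim.
data Line : Set where
  ∅ ★ a0 a1 a2 a3 a4 b0 b1 b2 b3 b4 : Line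

infix 7 _∌_ _#_ _##_

_∌_ : Line → Pt → Bool
★ ∌ hub = false
a0 ∌ v0 = false
a1 ∌ v1 = false
a2 ∌ v2 = false
a3 ∌ v3 = false
a4 ∌ v4 = false
b0 ∌ v0 = false
b0 ∌ v2 = false
b1 ∌ v1 = false
b1 ∌ v3 = false
b2 ∌ v2 = false
b2 ∌ v4 = false
b3 ∌ v3 = false
b3 ∌ v0 = false
b4 ∌ v4 = false
b4 ∌ v1 = false
_ ∌ _ = true

_#_ : Line → Line → Bool
∅ # _ = true
★ # l = l ∌ hub
a0 # l = l ∌ v0
a1 # l = l ∌ v1
a2 # l = l ∌ v2
a3 # l = l ∌ v3
a4 # l = l ∌ v4
b0 # l = (l ∌ v0) ∧ (l ∌ v2)
b1 # l = (l ∌ v1) ∧ (l ∌ v3)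
b2 # l = (l ∌ v2) ∧ (l ∌ v4)
b3 # l = (l ∌ v3) ∧ (l ∌ v0)
b4 # l = (l ∌ v4) ∧ (l ∌ v1)

pts : List Pt
pts = v0 ∷ v1 ∷ v2 ∷ v3 ∷ v4 ∷ hub ∷ []

lines : List Line
lines = ∅ ∷ ★ ∷ a0 ∷ a1 ∷ a2 ∷ a3 ∷ a4 ∷ b0 ∷ b1 ∷ b2 ∷ b3 ∷ b4 ∷ []

∈-lines : ∀ l → l ∈ lines
∈-lines ∅  = here refl
∈-lines ★  = there (here refl)
∈-lines a0 = there (there (here refl))
∈-lines a1 = there (there (there (here refl)))
∈-lines a2 = there (there (there (there (here refl))))
∈-lines a3 = there (there (there (there (there (here refl)))))
∈-lines a4 = there (there (there (there (there (there (here refl))))))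
∈-lines b0 = there (there (there (there (there (there (there (here refl)))))))
∈-lines b1 = there (there (there (there (there (there (there (there (here refl))))))))
∈-lines b2 = there (there (there (there (there (there (there (there (there (here refl)))))))))
∈-lines b3 = there (there (there (there (there (there (there (there (there (there (here refl))))))))))
∈-lines b4 = there (there (there (there (there (there (there (there (there (there (there (here refl)))))))))))

∧-T : ∀ {x y} → T x → T y → T (x ∧ y)
∧-T p q = Equivalence.from T-∧ (p , q)

T-∧ˡ : ∀ {x y} → T (x ∧ y) → T x
T-∧ˡ = proj₁ ∘ Equivalence.to T-∧

T-∧ʳ : ∀ {x y} → T (x ∧ y) → T y
T-∧ʳ {x} = proj₂ ∘ Equivalence.to (T-∧ {x})

infixr 5 _⇒_

_⇒_ : Bool → Bool → Bool
true  ⇒ y = y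
false ⇒ _ = true

⇒-elim : ∀ {x y} → T (x ⇒ y) → T x → T y
⇒-elim {true} p _ = p

∈-all : ∀ {p : A → Bool} {xs x} → T (all p xs) → x ∈ xs → T (p x)
∈-all {p = p} {xs} h = All.lookup (all⁺ p xs h)

-- There are only twelve lines, so a Boolean statement about lines is settled by evaluation: its
-- hypothesis is then proved by `tt`.
∀line : (p : Line → Bool) → T (all p lines) → ∀ l → T (p l)
∀line p h l = ∈-all {p = p} h (∈-lines l)

∀line² : (p : Line → Line → Bool) → T (all (λ l → all (p l) lines) lines) →
         ∀ l m → T (p l m)
∀line² p h l = ∀line (p l) (∀line (λ l → all (p l) lines) h l)

∀line³ : (p : Line → Line → Line → Bool) →
         T (all (λ l → all (λ m → all (p l m) lines) lines) lines) →
         ∀ l m n → T (p l m n)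
∀line³ p h l = ∀line² (p l) (∀line (λ l → all (λ m → all (p l m) lines) lines) h l)

#-sym : ∀ l m → T (l # m) → T (m # l)
#-sym l m = ⇒-elim (∀line² (λ l m → l # m ⇒ m # l) tt l m)

#-∅ : ∀ l → T (l # ∅)
#-∅ = ∀line (_# ∅) tt

∌⇒# : ∀ l m → T (all (λ v → l ∌ v ∨ m ∌ v) pts) → T (l # m)
∌⇒# l m = ⇒-elim (∀line² (λ l m → all (λ v → l ∌ v ∨ m ∌ v) pts ⇒ l # m) tt l m)

-- Weights and slices

data Shape : Set where
  none star one two : Shape

shape : Line → Shape
shape ∅  = none
shape ★  = star
shape a0 = one
shape a1 = one
shape a2 = one
shape a3 = one
shape a4 = one
shape _  = two

weigh : ℕ → ℕ → Shape → ℕ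
weigh r s none = 0
weigh r s star = s
weigh r s one  = r
weigh r s two  = r + r

-- Factoring through `shape` makes every weight invariant under a map of lines that preserves
-- shapes.
wt : ℕ → ℕ → Line → ℕ
wt r s l = weigh r s (shape l)

-- A set of vertices of W₅ □ W₅, given by its sections over the rim vertices and over the hub.
record Slice : Set where
  constructor slice
  field
    r0 r1 r2 r3 r4 rh : Line

open Slice

_##_ : Slice → Slice → Bool
slice a b c d e h ## slice a' b' c' d' e' h' =
  a # a' ∧ b # b' ∧ c # c' ∧ d # d' ∧ e # e' ∧ h # h'

empty : Slice
empty = slice ∅ ∅ ∅ ∅ ∅ ∅

-- Every line is independent already, so these conditions amount to independence in `W₅ □ W₅`. In
-- each pair the row that the search chooses later comes first.
Stable : Slice → Set
Stable (slice a b c d e h) =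
  (T (b # a) × T (c # b) × T (d # c) × T (e # d) × T (e # a)) ×
  (T (a # h) × T (b # h) × T (c # h) × T (d # h) × T (e # h))

Apart : Slice → Slice → Set
Apart (slice a b c d e h) (slice a' b' c' d' e' h') =
  T (a # a') × T (b # b') × T (c # c') × T (d # d') × T (e # e') × T (h # h')

Apart-sym : ∀ D E → Apart D E → Apart E D
Apart-sym D E (a , b , c , d , e , h) =
  #-sym (r0 D) (r0 E) a , #-sym (r1 D) (r1 E) b , #-sym (r2 D) (r2 E) c ,
  #-sym (r3 D) (r3 E) d , #-sym (r4 D) (r4 E) e , #-sym (rh D) (rh E) h

Apart-empty : ∀ D → Apart D empty
Apart-empty (slice a b c d e h) = #-∅ a , #-∅ b , #-∅ c , #-∅ d , #-∅ e , #-∅ h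

Apart⇒## : ∀ D E → Apart D E → T (D ## E)
Apart⇒## D E (a , b , c , d , e , h) =
  ∧-T {r0 D # r0 E} a (∧-T {r1 D # r1 E} b (∧-T {r2 D # r2 E} c
    (∧-T {r3 D # r3 E} d (∧-T {r4 D # r4 E} e h))))

-- The terms stand in the order in which the search adds them, so that its running total is `weight`
-- by definition. `K` supplies a parameter for the weight of each rim row.
weight : (Line → Line → ℕ) → (Line → ℕ) → Slice → Slice → ℕ
weight w u K (slice a b c d e h) =
  w (r4 K) e + (w (r3 K) d + (w (r2 K) c + (w (r1 K) b + (w (r0 K) a + (u h + 0)))))

-- Here n is the number of rows still to be chosen, each of weight at most cap.
grow : (Line → ℕ) → ℕ → ℕ → ℕ → Line → Line → Line → ℕ → (Line → ℕ → List A) → List A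
grow {A} f cap n t x y z s c = concatMap (λ l → try l (f l + s)) lines
  where
  try : Line → ℕ → List A
  try l s′ = if l # y ∧ l # x ∧ l # z ∧ (t ≤ᵇ n * cap + s′) then c l s′ else []

∈-if : ∀ {b} {x : A} {xs} → T b → x ∈ xs → x ∈ (if b then xs else [])
∈-if {b = true} _ p = p

∈-grow : ∀ f cap n t x y z s (c : Line → ℕ → List A) l {v} →
         T (l # y) → T (l # x) → T (l # z) → t ≤ n * cap + (f l + s) →
         v ∈ c l (f l + s) → v ∈ grow f cap n t x y z s c
∈-grow {A} f cap n t x y z s c l {v} ly lx lz t≤ v∈ =
  ∈-concatMap⁺ step (lose {P = λ m → v ∈ step m} (∈-lines l)
    (∈-if (∧-T {l # y} ly (∧-T {l # x} lx (∧-T {l # z} lz (≤⇒≤ᵇ t≤)))) v∈))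
  where
  step : Line → List A
  step m = if m # y ∧ m # x ∧ m # z ∧ (t ≤ᵇ n * cap + (f m + s)) then c m (f m + s) else []

module Search (w : Line → Line → ℕ) (u : Line → ℕ) (cap : ℕ) where

  module _ (t : ℕ) (X K : Slice) where

    -- The test closes the cycle of rim rows; all other adjacent rows are compared in `grow`.
    complete : Line → Line → Line → Line → Line → Line → ℕ → List (ℕ × Slice)
    complete h a b c d e s = if e # a then (s , slice a b c d e h) ∷ [] else []

    from4 : Line → Line → Line → Line → Line → ℕ → List (ℕ × Slice)
    from4 h a b c d s = grow (w (r4 K)) cap 0 t (r4 X) h d s (complete h a b c d)

    from3 : Line → Line → Line → Line → ℕ → List (ℕ × Slice)
    from3 h a b c s = grow (w (r3 K)) cap 1 t (r3 X) h c s (from4 h a b c)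

    from2 : Line → Line → Line → ℕ → List (ℕ × Slice)
    from2 h a b s = grow (w (r2 K)) cap 2 t (r2 X) h b s (from3 h a b)

    from1 : Line → Line → ℕ → List (ℕ × Slice)
    from1 h a s = grow (w (r1 K)) cap 3 t (r1 X) h a s (from2 h a)

    from0 : Line → ℕ → List (ℕ × Slice)
    from0 h s = grow (w (r0 K)) cap 4 t (r0 X) h ∅ s (from1 h)

    -- Opaque, since conversion checking would unfold it on open terms.
    opaque
      search : List (ℕ × Slice)
      search = grow u cap 5 t (rh X) ∅ ∅ 0 from0

  module _ (w≤cap : ∀ k l → w k l ≤ cap) where

    -- Used backwards along the search: a slice that reaches `t` in the end passes every earlier
    -- pruning test, because each row chosen later weighs at most `cap`.
    climb : ∀ {t} n {x s} → x ≤ cap → t ≤ n * cap + (x + s) → t ≤ suc n * cap + s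
    climb {t} n {x} {s} x≤cap t≤ = begin
      t                  ≤⟨ t≤ ⟩
      n * cap + (x + s)  ≡⟨ +-assoc (n * cap) x s ⟨
      n * cap + x + s    ≤⟨ +-monoˡ-≤ s (+-monoʳ-≤ (n * cap) x≤cap) ⟩
      n * cap + cap + s  ≡⟨ cong (_+ s) (+-comm (n * cap) cap) ⟩
      suc n * cap + s    ∎
      where open ≤-Reasoning

    opaque
      unfolding search

      -- Completeness is the direction a refutation relies on: a candidate too many could only make
      -- a check fail.
      ∈-search : ∀ t X K D → Stable D → Apart D X → t ≤ weight w u K D →
                 (weight w u K D , D) ∈ search t X K
      ∈-search t X K (slice a b c d e h)
               ((ba , cb , dc , ed , ea) , (ah , bh , ch , dh , eh))
               (xa , xb , xc , xd , xe , xh) t4 =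
        let t3 = climb 0 (w≤cap (r4 K) e) t4
            t2 = climb 1 (w≤cap (r3 K) d) t3
            t1 = climb 2 (w≤cap (r2 K) c) t2
            t0 = climb 3 (w≤cap (r1 K) b) t1
            th = climb 4 (w≤cap (r0 K) a) t0
        in
        ∈-grow u cap 5 t (rh X) ∅ ∅ 0 (from0 t X K) h (#-∅ h) xh (#-∅ h) th (
        ∈-grow (w (r0 K)) cap 4 t (r0 X) h ∅ _ (from1 t X K h) a ah xa (#-∅ a) t0 (
        ∈-grow (w (r1 K)) cap 3 t (r1 X) h a _ (from2 t X K h a) b bh xb ba t1 (
        ∈-grow (w (r2 K)) cap 2 t (r2 X) h b _ (from3 t X K h a b) c ch xc cb t2 (
        ∈-grow (w (r3 K)) cap 1 t (r3 X) h c _ (from4 t X K h a b c) d dh xd dc t3 (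
        ∈-grow (w (r4 K)) cap 0 t (r4 X) h d _ (complete t X K h a b c d) e eh xe ed t4 (
        ∈-if ea (here refl)))))))

-- Profits, costs and the reduction at holes

-- At a vertex with 0, 1 or 2 coordinates at the hub, ω is twice 3, 4, 2 in the five rim
-- slices of W₅ □ W₅ □ W₅ and 8, 7, 4 in the hub slice.
profit : Slice → ℕ
profit = weight (λ _ → wt 3 4) (wt 4 2) empty

cost : Slice → ℕ
cost = weight (λ _ → wt 8 7) (wt 7 4) empty

-- The rim vertex between the two of bᵢ.
mid : Line → Line
mid b0 = a1
mid b1 = a2
mid b2 = a3
mid b3 = a4
mid b4 = a0
mid _  = ∅

meets : Line → Line → ℕ
meets k l = if mid k # l then 0 else 1

gap : Line → ℕ
gap k = count (shape k)
  where
  count : Shape → ℕ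
  count two = 1
  count _   = 0

gaps : Slice → ℕ
gaps (slice a b c d e _) = gap a + (gap b + (gap c + (gap d + gap e)))

-- A vertex lies in at most two of five cyclically disjoint slices, so taking 3 units off it
-- costs them at most 6 in total. This is done at the holes of the hub slice, the rim vertices
-- all of whose four rim neighbours it contains.
reduced : Line → Line → ℕ
reduced k l = if mid k # l then wt 6 8 l else wt 6 8 l ∸ 3

-- A hole is recorded by the line `bᵢ` around it, from which `mid` recovers the vertex. A line of
-- any other shape has `mid` equal to `∅`, passes the test and becomes `∅`.
hole : Line → Line → Line → Line
hole k up down = if mid k # up ∨ mid k # down then ∅ else k

holes : Slice → Slice
holes (slice a b c d e h) =
  slice (hole a e b) (hole b a c) (hole c b d) (hole d c e) (hole e d a) ∅

-- The caps are the weights 6 + 6 and 8 + 8 of two rim vertices in one line.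
module Profits = Search reduced (wt 8 4) 12
module Costs   = Search (λ _ → wt 8 7) (wt 7 4) 16

residue : Slice → Slice → ℕ
residue = weight reduced (wt 8 4)

Candidate : Set
Candidate = ℕ × Slice

-- Refuting a hub slice

-- If L contains all slices of residue at least t, this excludes five cyclically disjoint ones of
-- total residue at least R and total profit at least need. The first two slices are the heaviest
-- pair, of residue p; since the others then split into pairs of residue at most p and a single
-- slice, every residue is at least R ∸ 2 * p.
module Refutation (need R t : ℕ) (L : List Candidate) where

  -- Total residue `R` is only necessary for the profit sought, since the allowance for the holes
  -- need not be used up. The survivors are therefore compared by their true profit.
  fifth : ℕ → ℕ → Slice → Candidate → Bool
  fifth q s D3 (x4 , D4) = (R ≤ᵇ q + x4) ∧ D3 ## D4 ⇒ (s + profit D4 <ᵇ need)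

  -- The slice still to come has residue at most that of the second slice, because together with the
  -- first it has at most `p`. `inner` puts this bound into `q` as the summand `x1`.
  fourth : List Candidate → ℕ → ℕ → ℕ → Candidate → Candidate → Bool
  fourth B p q s (x2 , D2) (x3 , D3) =
    (R ≤ᵇ q + x3) ∧ (x2 + x3 ≤ᵇ p) ∧ D2 ## D3 ⇒
      all (fifth (p + x2 + x3) (s + profit D2 + profit D3) D3) B

  third : List Candidate → List Candidate → ℕ → ℕ → ℕ → Candidate → Bool
  third Lp B p q s c@(x2 , _) = all (fourth B p (q + x2) s c) Lp

  inner : Candidate → Candidate → ℕ → List Candidate → Bool
  inner (x0 , D0) (x1 , D1) p Lp =
    all (third Lp (filterᵇ (λ (x , D) → (x0 + x ≤ᵇ p) ∧ D0 ## D) Lp) p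
               (p + x1) (profit D0 + profit D1))
        (filterᵇ (λ (x , D) → (x1 + x ≤ᵇ p) ∧ D1 ## D) Lp)

  path : Candidate → Candidate → ℕ → Bool
  path c d p = (t + 2 * p ≤ᵇ R) ∧ inner c d p (filterᵇ (λ (x , _) → R ≤ᵇ 2 * p + x) L)

  second : Candidate → Candidate → Bool
  second c@(x0 , D0) d@(x1 , D1) =
    (x1 ≤ᵇ x0) ∧ (2 * R ≤ᵇ 5 * (x0 + x1)) ∧ D0 ## D1 ⇒ path c d (x0 + x1)

  first : Candidate → Bool
  first c = all (second c) L

  refutes : Bool
  refutes = all first (filterᵇ (λ (x , _) → R ≤ᵇ 5 * x) L)

-- Residues are at most 64, so 64 would do for the heaviest pair; with 66 the list also contains
-- the other slices, which is what the first test in path verifies.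
floor : ℕ → ℕ
floor R = (2 * R + 4) div 5 ∸ 66

-- The least total profit with which five slices and a hub slice of cost g exceed 378.
demand : ℕ → ℕ
demand g = ⌊ 380 ∸ g /2⌋

refuting : ℕ → Slice → Bool
refuting g H = go (demand g) (holes H)
  where
  go″ : ℕ → ℕ → ℕ → Slice → Bool
  go″ need R t J = Refutation.refutes need R t (Profits.search t H J)

  go′ : ℕ → ℕ → Slice → Bool
  go′ need R J = go″ need R (floor R) J

  go : ℕ → Slice → Bool
  go need J = go′ need (2 * need ∸ 6 * gaps J) J

-- Symmetries of W₅ □ W₅

rot ref : Line → Line
rot ∅  = ∅
rot ★  = ★
rot a0 = a1
rot a1 = a2
rot a2 = a3
rot a3 = a4
rot a4 = a0
rot b0 = b1
rot b1 = b2
rot b2 = b3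
rot b3 = b4
rot b4 = b0
ref ∅  = ∅
ref ★  = ★
ref a0 = a0
ref a1 = a4
ref a2 = a3
ref a3 = a2
ref a4 = a1
ref b0 = b3
ref b1 = b2
ref b2 = b1
ref b3 = b0
ref b4 = b4

-- These are the properties by which a hub slice and its cycle of rim slices are carried, with their
-- weights, to another such configuration.
record Symmetry : Set where
  field
    map-slice     : Slice → Slice
    stable        : ∀ D → Stable D → Stable (map-slice D)
    apart         : ∀ D E → Apart D E → Apart (map-slice D) (map-slice E)
    same-profit   : ∀ D → profit (map-slice D) ≡ profit D
    same-cost     : ∀ D → cost (map-slice D) ≡ cost D

open Symmetry

infixr 9 _⊚_

_⊚_ : Symmetry → Symmetry → Symmetry
σ ⊚ τ = record
  { map-slice   = map-slice σ ∘ map-slice τ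
  ; stable      = λ D → stable σ _ ∘ stable τ D
  ; apart       = λ D E → apart σ _ _ ∘ apart τ D E
  ; same-profit = λ D → trans (same-profit σ _) (same-profit τ D)
  ; same-cost   = λ D → trans (same-cost σ _) (same-cost τ D)
  }

identity : Symmetry
identity = record
  { map-slice   = id
  ; stable      = λ _ → id
  ; apart       = λ _ _ → id
  ; same-profit = λ _ → refl
  ; same-cost   = λ _ → refl
  }

-- `f` acts on the last coordinate; `turn` and `flip` act on the one before it.
module OnLines (f : Line → Line) (f-# : ∀ l m → T (l # m) → T (f l # f m))
               (f-shape : ∀ l → shape (f l) ≡ shape l) where

  wt-f : ∀ r s l → wt r s (f l) ≡ wt r s l
  wt-f r s l = cong (weigh r s) (f-shape l)

  on-lines : Slice → Slice
  on-lines (slice a b c d e h) = slice (f a) (f b) (f c) (f d) (f e) (f h)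

  weight-on-lines : ∀ {r s r′ s′} D →
    weight (λ _ → wt r s) (wt r′ s′) empty (on-lines D) ≡ weight (λ _ → wt r s) (wt r′ s′) empty D
  weight-on-lines {r} {s} {r′} {s′} (slice a b c d e h) =
    cong₂ _+_ (wt-f r s e) (cong₂ _+_ (wt-f r s d) (cong₂ _+_ (wt-f r s c)
      (cong₂ _+_ (wt-f r s b) (cong₂ _+_ (wt-f r s a) (cong (_+ 0) (wt-f r′ s′ h))))))

  symmetry : Symmetry
  symmetry = record
    { map-slice   = on-lines
    ; stable      = λ { (slice a b c d e h) ((ba , cb , dc , ed , ea) , (ah , bh , ch , dh , eh)) →
        (f-# b a ba , f-# c b cb , f-# d c dc , f-# e d ed , f-# e a ea) ,
        (f-# a h ah , f-# b h bh , f-# c h ch , f-# d h dh , f-# e h eh) }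
    ; apart       = λ { (slice a b c d e h) (slice a′ b′ c′ d′ e′ h′) (pa , pb , pc , pd , pe , ph) →
        f-# a a′ pa , f-# b b′ pb , f-# c c′ pc , f-# d d′ pd , f-# e e′ pe , f-# h h′ ph }
    ; same-profit = weight-on-lines
    ; same-cost   = weight-on-lines
    }

shape-rot : ∀ l → shape (rot l) ≡ shape l
shape-rot ∅  = refl
shape-rot ★  = refl
shape-rot a0 = refl
shape-rot a1 = refl
shape-rot a2 = refl
shape-rot a3 = refl
shape-rot a4 = refl
shape-rot b0 = refl
shape-rot b1 = refl
shape-rot b2 = refl
shape-rot b3 = refl
shape-rot b4 = refl

shape-ref : ∀ l → shape (ref l) ≡ shape l
shape-ref ∅  = refl
shape-ref ★  = refl
shape-ref a0 = refl
shape-ref a1 = refl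
shape-ref a2 = refl
shape-ref a3 = refl
shape-ref a4 = refl
shape-ref b0 = refl
shape-ref b1 = refl
shape-ref b2 = refl
shape-ref b3 = refl
shape-ref b4 = refl

rotation reflection turn flip : Symmetry
rotation = OnLines.symmetry rot
  (λ l m → ⇒-elim (∀line² (λ l m → l # m ⇒ rot l # rot m) tt l m)) shape-rot
reflection = OnLines.symmetry ref
  (λ l m → ⇒-elim (∀line² (λ l m → l # m ⇒ ref l # ref m) tt l m)) shape-ref
turn = record
  { map-slice   = λ { (slice a b c d e h) → slice b c d e a h }
  ; stable      = λ { (slice a b c d e h) ((ba , cb , dc , ed , ea) , (ah , bh , ch , dh , eh)) →
      (cb , dc , ed , #-sym e a ea , #-sym b a ba) , (bh , ch , dh , eh , ah) }
  ; apart       = λ { D E (a , b , c , d , e , h) → b , c , d , e , a , h }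
  ; same-profit = same 3 4 4 2
  ; same-cost   = same 8 7 7 4
  }
  where
  cycled : ∀ a b c d e h → a + (e + (d + (c + (b + h)))) ≡ e + (d + (c + (b + (a + h))))
  cycled = solve-∀

  same : ∀ r s r′ s′ → ((slice a b c d e h) : Slice) →
         weight (λ _ → wt r s) (wt r′ s′) empty (slice b c d e a h) ≡
         weight (λ _ → wt r s) (wt r′ s′) empty (slice a b c d e h)
  same r s r′ s′ (slice a b c d e h) =
    cycled (wt r s a) (wt r s b) (wt r s c) (wt r s d) (wt r s e) (wt r′ s′ h + 0)
flip = record
  { map-slice   = λ { (slice a b c d e h) → slice a e d c b h }
  ; stable      = λ { (slice a b c d e h) ((ba , cb , dc , ed , ea) , (ah , bh , ch , dh , eh)) →
      (ea , #-sym e d ed , #-sym d c dc , #-sym c b cb , ba) , (ah , eh , dh , ch , bh) }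
  ; apart       = λ { D E (a , b , c , d , e , h) → a , e , d , c , b , h }
  ; same-profit = same 3 4 4 2
  ; same-cost   = same 8 7 7 4
  }
  where
  reversed : ∀ a b c d e h → b + (c + (d + (e + (a + h)))) ≡ e + (d + (c + (b + (a + h))))
  reversed = solve-∀

  same : ∀ r s r′ s′ → ((slice a b c d e h) : Slice) →
         weight (λ _ → wt r s) (wt r′ s′) empty (slice a e d c b h) ≡
         weight (λ _ → wt r s) (wt r′ s′) empty (slice a b c d e h)
  same r s r′ s′ (slice a b c d e h) =
    reversed (wt r s a) (wt r s b) (wt r s c) (wt r s d) (wt r s e) (wt r′ s′ h + 0)

powers : Symmetry → ℕ → List Symmetry
powers σ zero    = []
powers σ (suc n) = identity ∷ map (σ ⊚_) (powers σ n)

products : List Symmetry → List Symmetry → List Symmetry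
products σs τs = concatMap (λ σ → map (σ ⊚_) τs) σs

-- The 100 elements of the product of two dihedral groups of order 10.
symmetries : List Symmetry
symmetries = products (products (powers rotation 5) (powers reflection 2))
                      (products (powers turn 5) (powers flip 2))

-- Codes of slices and the verification up to symmetry

digit : Line → ℕ
digit ∅  = 0
digit ★  = 1
digit a0 = 2
digit a1 = 3
digit a2 = 4
digit a3 = 5
digit a4 = 6
digit b0 = 7
digit b1 = 8
digit b2 = 9
digit b3 = 10
digit b4 = 11

-- Opaque, since the multiplications by 12 would be unfolded into sums.
opaque
  code : Slice → ℕ
  code (slice a b c d e h) =
    digit e + 12 * (digit d + 12 * (digit c + 12 * (digit b + 12 * (digit a + 12 * digit h))))

minimal : ℕ → Slice → Bool
minimal n H = all (λ σ → n ≤ᵇ code (map-slice σ H)) symmetries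

refuted : Candidate → Bool
refuted (g , H) = minimal (code H) H ⇒ refuting g H

opaque
  unfolding Costs.search code

  -- Since profits are at most 32, only hub slices of cost at least 59 = 379 ∸ 2 * 5 * 32 matter.
  all-refuted : all refuted (Costs.search 59 empty empty) ≡ true
  all-refuted = refl

-- Bounds for single lines

≤-line² : (f g : Line → Line → ℕ) → T (all (λ k → all (λ l → f k l ≤ᵇ g k l) lines) lines) →
          ∀ k l → f k l ≤ g k l
≤-line² f g h k l = ≤ᵇ⇒≤ (f k l) (g k l) (∀line² (λ k l → f k l ≤ᵇ g k l) h k l)

reduced≤12 : ∀ k l → reduced k l ≤ 12
reduced≤12 = ≤-line² reduced (λ _ _ → 12) tt

reduced≤ : ∀ k l → reduced k l ≤ wt 6 8 l
reduced≤ = ≤-line² reduced (λ _ → wt 6 8) tt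

≤reduced : ∀ k l → wt 6 8 l ≤ reduced k l + 3 * meets k l
≤reduced = ≤-line² (λ _ → wt 6 8) (λ k l → reduced k l + 3 * meets k l) tt

gap≤1 : ∀ k → gap k ≤ 1
gap≤1 k = ≤ᵇ⇒≤ (gap k) 1 (∀line (λ k → gap k ≤ᵇ 1) tt k)

-- The vertex of `mid k` lies in at most one of two disjoint lines, and there is such a vertex only
-- if `k` has two points.
meets-pair : ∀ k l m → T (l # m) → meets k l + meets k m ≤ gap k
meets-pair k l m l#m = ≤ᵇ⇒≤ _ _ (⇒-elim
  (∀line³ (λ k l m → l # m ⇒ (meets k l + meets k m ≤ᵇ gap k)) tt k l m) l#m)

-- Cycles of five slices

wt-double : ∀ r s l → wt (r + r) (s + s) l ≡ 2 * wt r s l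
wt-double r s l = weigh-double (shape l)
  where
  weigh-double : ∀ k → weigh (r + r) (s + s) k ≡ 2 * weigh r s k
  weigh-double none = refl
  weigh-double star = cong (s +_) (sym (+-identityʳ s))
  weigh-double one  = cong (r +_) (sym (+-identityʳ r))
  weigh-double two  = cong (r + r +_) (sym (+-identityʳ (r + r)))

weight-double : ∀ r s r′ s′ D →
  weight (λ _ → wt (r + r) (s + s)) (wt (r′ + r′) (s′ + s′)) empty D ≡
  2 * weight (λ _ → wt r s) (wt r′ s′) empty D
weight-double r s r′ s′ (slice a b c d e h)
  rewrite wt-double r s a | wt-double r s b | wt-double r s c | wt-double r s d
        | wt-double r s e | wt-double r′ s′ h =
  distrib (wt r s a) (wt r s b) (wt r s c) (wt r s d) (wt r s e) (wt r′ s′ h)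
  where
  distrib : ∀ a b c d e h →
            2 * e + (2 * d + (2 * c + (2 * b + (2 * a + (2 * h + 0))))) ≡
            2 * (e + (d + (c + (b + (a + (h + 0))))))
  distrib = solve-∀

hits : Slice → Slice → ℕ
hits J D = meets (r4 J) (r4 D) + (meets (r3 J) (r3 D) + (meets (r2 J) (r2 D) +
             (meets (r1 J) (r1 D) + meets (r0 J) (r0 D))))

residue≤ : ∀ J D → residue J D ≤ 2 * profit D
residue≤ J D@(slice a b c d e h) = begin
  residue J D
    ≤⟨ +-mono-≤ (reduced≤ (r4 J) e) (+-mono-≤ (reduced≤ (r3 J) d) (+-mono-≤ (reduced≤ (r2 J) c)
         (+-mono-≤ (reduced≤ (r1 J) b) (+-monoˡ-≤ (wt 8 4 h + 0) (reduced≤ (r0 J) a))))) ⟩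
  weight (λ _ → wt 6 8) (wt 8 4) empty D
    ≡⟨ weight-double 3 4 4 2 D ⟩
  2 * profit D
    ∎
  where open ≤-Reasoning

≤residue : ∀ J D → 2 * profit D ≤ residue J D + 3 * hits J D
≤residue J D@(slice a b c d e h) = begin
  2 * profit D
    ≡⟨ weight-double 3 4 4 2 D ⟨
  weight (λ _ → wt 6 8) (wt 8 4) empty D
    ≤⟨ +-mono-≤ (≤reduced (r4 J) e) (+-mono-≤ (≤reduced (r3 J) d) (+-mono-≤ (≤reduced (r2 J) c)
         (+-mono-≤ (≤reduced (r1 J) b) (+-monoˡ-≤ (wt 8 4 h + 0) (≤reduced (r0 J) a))))) ⟩
  _ ≡⟨ collect (reduced (r0 J) a) (reduced (r1 J) b) (reduced (r2 J) c) (reduced (r3 J) d)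
         (reduced (r4 J) e) (wt 8 4 h + 0) (meets (r0 J) a) (meets (r1 J) b) (meets (r2 J) c)
         (meets (r3 J) d) (meets (r4 J) e) ⟩
  residue J D + 3 * hits J D
    ∎
  where
  open ≤-Reasoning

  collect : ∀ a b c d e h a′ b′ c′ d′ e′ →
    e + 3 * e′ + (d + 3 * d′ + (c + 3 * c′ + (b + 3 * b′ + (a + 3 * a′ + h)))) ≡
    e + (d + (c + (b + (a + h)))) + 3 * (e′ + (d′ + (c′ + (b′ + a′))))
  collect = solve-∀

sum₅ : ℕ → ℕ → ℕ → ℕ → ℕ → ℕ
sum₅ a b c d e = a + b + c + d + e

sum₅-+ : ∀ a b c d e a′ b′ c′ d′ e′ →
         sum₅ (a + a′) (b + b′) (c + c′) (d + d′) (e + e′) ≡ sum₅ a b c d e + sum₅ a′ b′ c′ d′ e′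
sum₅-+ = expanded
  where
  expanded : ∀ a b c d e a′ b′ c′ d′ e′ →
             a + a′ + (b + b′) + (c + c′) + (d + d′) + (e + e′) ≡
             a + b + c + d + e + (a′ + b′ + c′ + d′ + e′)
  expanded = solve-∀

sum₅-mono : ∀ {a b c d e a′ b′ c′ d′ e′} → a ≤ a′ → b ≤ b′ → c ≤ c′ → d ≤ d′ → e ≤ e′ →
            sum₅ a b c d e ≤ sum₅ a′ b′ c′ d′ e′
sum₅-mono p q r s t = +-mono-≤ (+-mono-≤ (+-mono-≤ (+-mono-≤ p q) r) s) t

2*sum₅ : ∀ a b c d e → 2 * sum₅ a b c d e ≡ sum₅ (a + b) (b + c) (c + d) (d + e) (e + a)
2*sum₅ = expanded
  where
  expanded : ∀ a b c d e → 2 * (a + b + c + d + e) ≡ a + b + (b + c) + (c + d) + (d + e) + (e + a)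
  expanded = solve-∀

5*≡ : ∀ n → n + n + n + n + n ≡ 5 * n
5*≡ = solve-∀

-- Each term occurs in exactly two of the five cyclic pairs.
half-pairs : ∀ {a b c d e n} → a + b ≤ n → b + c ≤ n → c + d ≤ n → d + e ≤ n → e + a ≤ n →
             2 * sum₅ a b c d e ≤ 5 * n
half-pairs {a} {b} {c} {d} {e} {n} p q r s t = begin
  2 * sum₅ a b c d e                              ≡⟨ 2*sum₅ a b c d e ⟩
  sum₅ (a + b) (b + c) (c + d) (d + e) (e + a)    ≤⟨ sum₅-mono p q r s t ⟩
  sum₅ n n n n n                                  ≡⟨ 5*≡ n ⟩
  5 * n                                           ∎
  where open ≤-Reasoning

record Cycle (H : Slice) (need : ℕ) : Set where
  field
    d0 d1 d2 d3 d4      : Slice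
    s0 : Stable d0
    s1 : Stable d1
    s2 : Stable d2
    s3 : Stable d3
    s4 : Stable d4
    h0 : Apart d0 H
    h1 : Apart d1 H
    h2 : Apart d2 H
    h3 : Apart d3 H
    h4 : Apart d4 H
    c01 : Apart d0 d1
    c12 : Apart d1 d2
    c23 : Apart d2 d3
    c34 : Apart d3 d4
    c40 : Apart d4 d0
    heavy : need ≤ sum₅ (profit d0) (profit d1) (profit d2) (profit d3) (profit d4)

open Cycle

rotate : ∀ {H n} → Cycle H n → Cycle H n
rotate c = record
  { d0 = d1 c ; d1 = d2 c ; d2 = d3 c ; d3 = d4 c ; d4 = d0 c
  ; s0 = s1 c ; s1 = s2 c ; s2 = s3 c ; s3 = s4 c ; s4 = s0 c
  ; h0 = h1 c ; h1 = h2 c ; h2 = h3 c ; h3 = h4 c ; h4 = h0 c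
  ; c01 = c12 c ; c12 = c23 c ; c23 = c34 c ; c34 = c40 c ; c40 = c01 c
  ; heavy = ≤-trans (heavy c) (≤-reflexive
      (cycled (profit (d0 c)) (profit (d1 c)) (profit (d2 c)) (profit (d3 c)) (profit (d4 c))))
  }
  where
  cycled : ∀ a b c d e → a + b + c + d + e ≡ b + c + d + e + a
  cycled = solve-∀

-- This is the reflection that exchanges `d0` and `d1`; it keeps the leading pair in front and
-- serves to make `d0` the heavier of the two.
reflect : ∀ {H n} → Cycle H n → Cycle H n
reflect c = record
  { d0 = d1 c ; d1 = d0 c ; d2 = d4 c ; d3 = d3 c ; d4 = d2 c
  ; s0 = s1 c ; s1 = s0 c ; s2 = s4 c ; s3 = s3 c ; s4 = s2 c
  ; h0 = h1 c ; h1 = h0 c ; h2 = h4 c ; h3 = h3 c ; h4 = h2 c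
  ; c01 = Apart-sym (d0 c) (d1 c) (c01 c) ; c12 = Apart-sym (d4 c) (d0 c) (c40 c)
  ; c23 = Apart-sym (d3 c) (d4 c) (c34 c) ; c34 = Apart-sym (d2 c) (d3 c) (c23 c)
  ; c40 = Apart-sym (d1 c) (d2 c) (c12 c)
  ; heavy = ≤-trans (heavy c) (≤-reflexive
      (reversed (profit (d0 c)) (profit (d1 c)) (profit (d2 c)) (profit (d3 c)) (profit (d4 c))))
  }
  where
  reversed : ∀ a b c d e → a + b + c + d + e ≡ b + a + e + d + c
  reversed = solve-∀

transport : ∀ {H n} (σ : Symmetry) → Cycle H n → Cycle (map-slice σ H) n
transport {H} {n} σ c = record
  { d0 = f (d0 c) ; d1 = f (d1 c) ; d2 = f (d2 c) ; d3 = f (d3 c) ; d4 = f (d4 c)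
  ; s0 = stable σ _ (s0 c) ; s1 = stable σ _ (s1 c) ; s2 = stable σ _ (s2 c)
  ; s3 = stable σ _ (s3 c) ; s4 = stable σ _ (s4 c)
  ; h0 = apart σ _ _ (h0 c) ; h1 = apart σ _ _ (h1 c) ; h2 = apart σ _ _ (h2 c)
  ; h3 = apart σ _ _ (h3 c) ; h4 = apart σ _ _ (h4 c)
  ; c01 = apart σ _ _ (c01 c) ; c12 = apart σ _ _ (c12 c) ; c23 = apart σ _ _ (c23 c)
  ; c34 = apart σ _ _ (c34 c) ; c40 = apart σ _ _ (c40 c)
  ; heavy = ≤-trans (heavy c) (sum₅-mono (same (d0 c)) (same (d1 c)) (same (d2 c))
                                         (same (d3 c)) (same (d4 c)))
  }
  where
  f : Slice → Slice
  f = map-slice σ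
  same : ∀ D → profit D ≤ profit (f D)
  same D = ≤-reflexive (sym (same-profit σ D))

-- The pairs alone give five halves of `gap k`. As `gap k` is at most 1 and the sum is an integer,
-- this rounds down to the stated bound.
meets-cycle : ∀ k {a b c d e} → T (a # b) → T (b # c) → T (c # d) → T (d # e) → T (e # a) →
              sum₅ (meets k a) (meets k b) (meets k c) (meets k d) (meets k e) ≤ 2 * gap k
meets-cycle k {a} {b} {c} {d} {e} ab bc cd de ea = ≤-pred (*-cancelˡ-< 2 _ _ (begin-strict
  2 * sum₅ (meets k a) (meets k b) (meets k c) (meets k d) (meets k e)
    ≤⟨ half-pairs {meets k a} (meets-pair k a b ab) (meets-pair k b c bc) (meets-pair k c d cd)
         (meets-pair k d e de) (meets-pair k e a ea) ⟩
  5 * gap k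
    ≤⟨ +-monoˡ-≤ (4 * gap k) (gap≤1 k) ⟩
  1 + 4 * gap k
    <⟨ n<1+n _ ⟩
  2 + 4 * gap k
    ≡⟨ regroup (gap k) ⟩
  2 * suc (2 * gap k)
    ∎))
  where
  open ≤-Reasoning
  regroup : ∀ n → 2 + 4 * n ≡ 2 * suc (2 * n)
  regroup = solve-∀

hits-cycle : ∀ J {A B C D E} → Apart A B → Apart B C → Apart C D → Apart D E → Apart E A →
             sum₅ (hits J A) (hits J B) (hits J C) (hits J D) (hits J E) ≤ 2 * gaps J
hits-cycle J {A} {B} {C} {D} {E} (aᵣ0 , aᵣ1 , aᵣ2 , aᵣ3 , aᵣ4 , _) (bᵣ0 , bᵣ1 , bᵣ2 , bᵣ3 , bᵣ4 , _)
           (cᵣ0 , cᵣ1 , cᵣ2 , cᵣ3 , cᵣ4 , _) (dᵣ0 , dᵣ1 , dᵣ2 , dᵣ3 , dᵣ4 , _) (eᵣ0 , eᵣ1 , eᵣ2 , eᵣ3 , eᵣ4 , _) =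
  begin
    sum₅ (hits J A) (hits J B) (hits J C) (hits J D) (hits J E)
      ≡⟨ split (m r4 A) (m r4 B) (m r4 C) (m r4 D) (m r4 E) _ _ _ _ _
        (split (m r3 A) (m r3 B) (m r3 C) (m r3 D) (m r3 E) _ _ _ _ _
        (split (m r2 A) (m r2 B) (m r2 C) (m r2 D) (m r2 E) _ _ _ _ _
        (sum₅-+ (m r1 A) (m r1 B) (m r1 C) (m r1 D) (m r1 E) _ _ _ _ _))) ⟩
    column r4 + (column r3 + (column r2 + (column r1 + column r0)))
      ≤⟨ +-mono-≤ (meets-cycle (r4 J) aᵣ4 bᵣ4 cᵣ4 dᵣ4 eᵣ4) (+-mono-≤ (meets-cycle (r3 J) aᵣ3 bᵣ3 cᵣ3 dᵣ3 eᵣ3)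
        (+-mono-≤ (meets-cycle (r2 J) aᵣ2 bᵣ2 cᵣ2 dᵣ2 eᵣ2) (+-mono-≤ (meets-cycle (r1 J) aᵣ1 bᵣ1 cᵣ1 dᵣ1 eᵣ1)
          (meets-cycle (r0 J) aᵣ0 bᵣ0 cᵣ0 dᵣ0 eᵣ0)))) ⟩
    _ ≡⟨ regroup (gap (r0 J)) (gap (r1 J)) (gap (r2 J)) (gap (r3 J)) (gap (r4 J)) ⟩
    2 * gaps J
      ∎
  where
  open ≤-Reasoning
  m : (Slice → Line) → Slice → ℕ
  m r X = meets (r J) (r X)

  column : (Slice → Line) → ℕ
  column r = sum₅ (m r A) (m r B) (m r C) (m r D) (m r E)

  split : ∀ a b c d e a′ b′ c′ d′ e′ {s} → sum₅ a′ b′ c′ d′ e′ ≡ s →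
          sum₅ (a + a′) (b + b′) (c + c′) (d + d′) (e + e′) ≡ sum₅ a b c d e + s
  split a b c d e a′ b′ c′ d′ e′ p =
    trans (sum₅-+ a b c d e a′ b′ c′ d′ e′) (cong (sum₅ a b c d e +_) p)

  regroup : ∀ a b c d e →
    2 * e + (2 * d + (2 * c + (2 * b + 2 * a))) ≡ 2 * (a + (b + (c + (d + e))))
  regroup = solve-∀

-- The search for stable slices of profit at least 33, with nothing to avoid, returns the empty
-- list.
profit≤32 : ∀ D → Stable D → profit D ≤ 32
profit≤32 D stable-D = ≤-pred (≰⇒> λ 33≤ → none-above
  (∈-search (λ _ l → ≤ᵇ⇒≤ (wt 3 4 l) 6 (∀line (λ l → wt 3 4 l ≤ᵇ 6) tt l))
            33 empty empty D stable-D (Apart-empty D) 33≤))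
  where
  open Search (λ _ → wt 3 4) (wt 4 2) 6

  opaque
    unfolding search

    nothing : search 33 empty empty ≡ []
    nothing = refl

  none-above : ∀ {x} → x ∈ search 33 empty empty → ⊥
  none-above {x} x∈ with () ← subst (x ∈_) nothing x∈

-- Soundness of the refutation

greatest : (f : A → ℕ) (x : A) (xs : List A) →
           ∃ λ y → y ∈ x ∷ xs × All (λ z → f z ≤ f y) (x ∷ xs)
greatest f x xs = argmax f x xs , argmax-all f (here refl) (All.tabulate there) ,
  f[⊥]≤f[argmax] {f = f} x xs ∷ f[xs]≤f[argmax] {f = f} x xs

module Soundness (H : Slice) (need : ℕ) where

  J : Slice
  J = holes H

  R t : ℕ
  R = 2 * need ∸ 6 * gaps J
  t = floor R

  L : List Candidate
  L = Profits.search t H J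

  L-complete : ∀ D → Stable D → Apart D H → t ≤ residue J D → (residue J D , D) ∈ L
  L-complete = Profits.∈-search reduced≤12 t H J

  open Refutation need R t L

  value : Slice → ℕ
  value = residue J

  pair : Cycle H need → ℕ
  pair c = value (d0 c) + value (d1 c)

  Within : ℕ → Cycle H need → Set
  Within p c = (value (d0 c) + value (d1 c) ≤ p) × (value (d1 c) + value (d2 c) ≤ p) ×
               (value (d2 c) + value (d3 c) ≤ p) × (value (d3 c) + value (d4 c) ≤ p) ×
               (value (d4 c) + value (d0 c) ≤ p)

  within-rotate : ∀ {p} c → Within p c → Within p (rotate c)
  within-rotate c (w01 , w12 , w23 , w34 , w40) = w12 , w23 , w34 , w40 , w01

  within-reflect : ∀ {p} c → Within p c → Within p (reflect c)
  within-reflect c (w01 , w12 , w23 , w34 , w40) =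
    comm (d0 c) (d1 c) w01 , comm (d4 c) (d0 c) w40 , comm (d3 c) (d4 c) w34 ,
    comm (d2 c) (d3 c) w23 , comm (d1 c) (d2 c) w12
    where
    comm : ∀ {p} A B → value A + value B ≤ p → value B + value A ≤ p
    comm {p} A B = subst (_≤ p) (+-comm (value A) (value B))

  -- In doubled units the reduction takes at most `6 * gaps J` from the five slices, by
  -- `hits-cycle`; `R` is the doubled demand less this loss.
  R≤total : (c : Cycle H need) →
            R ≤ sum₅ (value (d0 c)) (value (d1 c)) (value (d2 c)) (value (d3 c)) (value (d4 c))
  R≤total c = m≤n+o⇒m∸n≤o (2 * need) (6 * gaps J) (begin
    2 * need
      ≤⟨ *-monoʳ-≤ 2 (heavy c) ⟩
    2 * sum₅ (profit (d0 c)) (profit (d1 c)) (profit (d2 c)) (profit (d3 c)) (profit (d4 c))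
      ≡⟨ 2*-sum₅ (profit (d0 c)) (profit (d1 c)) (profit (d2 c)) (profit (d3 c)) (profit (d4 c)) ⟩
    sum₅ (2 * profit (d0 c)) (2 * profit (d1 c)) (2 * profit (d2 c)) (2 * profit (d3 c))
         (2 * profit (d4 c))
      ≤⟨ sum₅-mono (≤residue J (d0 c)) (≤residue J (d1 c)) (≤residue J (d2 c)) (≤residue J (d3 c))
           (≤residue J (d4 c)) ⟩
    sum₅ (value (d0 c) + 3 * hits J (d0 c)) (value (d1 c) + 3 * hits J (d1 c))
         (value (d2 c) + 3 * hits J (d2 c)) (value (d3 c) + 3 * hits J (d3 c))
         (value (d4 c) + 3 * hits J (d4 c))
      ≡⟨ sum₅-+ (value (d0 c)) (value (d1 c)) (value (d2 c)) (value (d3 c)) (value (d4 c)) _ _ _ _ _ ⟩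
    total + sum₅ (3 * hits J (d0 c)) (3 * hits J (d1 c)) (3 * hits J (d2 c)) (3 * hits J (d3 c))
                 (3 * hits J (d4 c))
      ≡⟨ cong (total +_)
           (3*-sum₅ (hits J (d0 c)) (hits J (d1 c)) (hits J (d2 c)) (hits J (d3 c)) (hits J (d4 c))) ⟩
    total + 3 * sum₅ (hits J (d0 c)) (hits J (d1 c)) (hits J (d2 c)) (hits J (d3 c)) (hits J (d4 c))
      ≤⟨ +-monoʳ-≤ total (*-monoʳ-≤ 3
           (hits-cycle J {d0 c} {d1 c} {d2 c} {d3 c} {d4 c} (c01 c) (c12 c) (c23 c) (c34 c) (c40 c))) ⟩
    total + 3 * (2 * gaps J)
      ≡⟨ cong (total +_) (*-assoc 3 2 (gaps J)) ⟨
    total + 6 * gaps J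
      ≡⟨ +-comm total (6 * gaps J) ⟩
    6 * gaps J + total
      ∎)
    where
    open ≤-Reasoning
    total : ℕ
    total = sum₅ (value (d0 c)) (value (d1 c)) (value (d2 c)) (value (d3 c)) (value (d4 c))

    2*-sum₅ : ∀ a b c d e → 2 * (a + b + c + d + e) ≡ 2 * a + 2 * b + 2 * c + 2 * d + 2 * e
    2*-sum₅ = solve-∀

    3*-sum₅ : ∀ a b c d e → 3 * a + 3 * b + 3 * c + 3 * d + 3 * e ≡ 3 * (a + b + c + d + e)
    3*-sum₅ = solve-∀

  module _ (sound : T refutes) where

    x≤64 : ∀ {D} → Stable D → value D ≤ 64
    x≤64 {D} s = ≤-trans (residue≤ J D) (*-monoʳ-≤ 2 (profit≤32 D s))

    -- The normal form assumed by the refutation: the leading pair is a heaviest one and its first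
    -- slice is the heavier. Such a cycle is followed through all the tests up to the contradiction
    -- in `absurd`.
    module _ (c : Cycle H need) (w : Within (pair c) c) (x1≤x0 : value (d1 c) ≤ value (d0 c)) where

      x0 x1 x2 x3 x4 p : ℕ
      x0 = value (d0 c)
      x1 = value (d1 c)
      x2 = value (d2 c)
      x3 = value (d3 c)
      x4 = value (d4 c)
      p  = pair c

      w12 : x1 + x2 ≤ p
      w12 = proj₁ (proj₂ w)
      w23 : x2 + x3 ≤ p
      w23 = proj₁ (proj₂ (proj₂ w))
      w34 : x3 + x4 ≤ p
      w34 = proj₁ (proj₂ (proj₂ (proj₂ w)))
      w40 : x4 + x0 ≤ p
      w40 = proj₂ (proj₂ (proj₂ (proj₂ w)))

      open ≤-Reasoning

      2R≤5p : 2 * R ≤ 5 * p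
      2R≤5p = ≤-trans (*-monoʳ-≤ 2 (R≤total c)) (half-pairs {x0} ≤-refl w12 w23 w34 w40)

      R≤5x0 : R ≤ 5 * x0
      R≤5x0 = *-cancelˡ-≤ 2 (begin
        2 * R         ≤⟨ 2R≤5p ⟩
        5 * (x0 + x1) ≤⟨ *-monoʳ-≤ 5 (+-monoʳ-≤ x0 x1≤x0) ⟩
        5 * (x0 + x0) ≡⟨ regroup x0 ⟩
        2 * (5 * x0)  ∎)
        where
        regroup : ∀ n → 5 * (n + n) ≡ 2 * (5 * n)
        regroup = solve-∀

      t≤x1 : t ≤ x1
      -- The quotient in `floor` is `2 * R` over 5 rounded up, hence at most `p`, which is `x0 + x1`
      -- with `x0` at most 64.
      t≤x1 = m≤n+o⇒m∸n≤o _ 66 (≤-trans (≤-pred (m<n*o⇒m/o<n {n = suc p} {o = 5} (begin-strict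
        2 * R + 4  ≤⟨ +-monoˡ-≤ 4 2R≤5p ⟩
        5 * p + 4  ≡⟨ cong (_+ 4) (*-comm 5 p) ⟩
        p * 5 + 4  <⟨ +-monoʳ-< (p * 5) (n<1+n 4) ⟩
        p * 5 + 5  ≡⟨ +-comm (p * 5) 5 ⟩
        suc p * 5  ∎))) (+-monoˡ-≤ x1 (≤-trans (x≤64 (s0 c)) (m≤n+m 64 2))))

      ∈-filterᵇ : ∀ {q : Candidate → Bool} {xs x} → x ∈ xs → T (q x) → x ∈ filterᵇ q xs
      ∈-filterᵇ {q} = ∈-filter⁺ (T? ∘ q)

      d0∈L : (x0 , d0 c) ∈ L
      d0∈L = L-complete (d0 c) (s0 c) (h0 c) (≤-trans t≤x1 x1≤x0)

      checked : T (path (x0 , d0 c) (x1 , d1 c) p)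
      checked = ⇒-elim
        (∈-all {p = second (x0 , d0 c)}
          (∈-all {p = first} sound
            (∈-filterᵇ {q = λ (x , _) → R ≤ᵇ 5 * x} d0∈L (≤⇒≤ᵇ R≤5x0)))
          (L-complete (d1 c) (s1 c) (h1 c) t≤x1))
        (∧-T {x1 ≤ᵇ x0} (≤⇒≤ᵇ x1≤x0) (∧-T {2 * R ≤ᵇ 5 * p} (≤⇒≤ᵇ 2R≤5p)
          (Apart⇒## (d0 c) (d1 c) (c01 c))))

      low : t + 2 * p ≤ R
      low = ≤ᵇ⇒≤ _ _ (T-∧ˡ checked)

      Lp : List Candidate
      Lp = filterᵇ (λ (x , _) → R ≤ᵇ 2 * p + x) L

      -- By `low` the threshold `R ∸ 2 * p` is at least `t`, so `L` is complete above it.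
      ∈-Lp : ∀ {D} → Stable D → Apart D H → R ≤ 2 * p + value D → (value D , D) ∈ Lp
      ∈-Lp {D} s h R≤ = ∈-filterᵇ {q = λ (x , _) → R ≤ᵇ 2 * p + x}
        (L-complete D s h (+-cancelʳ-≤ (2 * p) t (value D) (begin
          t + 2 * p        ≤⟨ low ⟩
          R                ≤⟨ R≤ ⟩
          2 * p + value D  ≡⟨ +-comm (2 * p) (value D) ⟩
          value D + 2 * p  ∎)))
        (≤⇒≤ᵇ R≤)

      -- Removing one slice from the cycle leaves two disjoint consecutive pairs, here `a` and `b`;
      -- the removed slice has to make up the rest.
      two-pairs : ∀ {a b n m} → a ≤ p → b ≤ p → n ≡ a + b + m → R ≤ n → R ≤ 2 * p + m
      two-pairs {a} {b} {n} {m} a≤p b≤p n≡ R≤n = begin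
        R          ≤⟨ R≤n ⟩
        n          ≡⟨ n≡ ⟩
        a + b + m  ≤⟨ +-monoˡ-≤ m (+-mono-≤ a≤p b≤p) ⟩
        p + p + m  ≡⟨ cong (λ q → p + q + m) (+-identityʳ p) ⟨
        2 * p + m  ∎

      d2∈Lp : (x2 , d2 c) ∈ Lp
      d2∈Lp = ∈-Lp (s2 c) (h2 c) (two-pairs ≤-refl w34 (regroup x0 x1 x2 x3 x4) (R≤total c))
        where
        regroup : ∀ a b c d e → a + b + c + d + e ≡ a + b + (d + e) + c
        regroup = solve-∀

      d3∈Lp : (x3 , d3 c) ∈ Lp
      d3∈Lp = ∈-Lp (s3 c) (h3 c) (two-pairs w12 w40 (regroup x0 x1 x2 x3 x4) (R≤total c))
        where
        regroup : ∀ a b c d e → a + b + c + d + e ≡ b + c + (e + a) + d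
        regroup = solve-∀

      d4∈Lp : (x4 , d4 c) ∈ Lp
      d4∈Lp = ∈-Lp (s4 c) (h4 c) (two-pairs ≤-refl w23 (regroup x0 x1 x2 x3 x4) (R≤total c))
        where
        regroup : ∀ a b c d e → a + b + c + d + e ≡ a + b + (c + d) + e
        regroup = solve-∀

      seconds lasts : List Candidate
      seconds = filterᵇ (λ (x , D) → (x1 + x ≤ᵇ p) ∧ d1 c ## D) Lp
      lasts = filterᵇ (λ (x , D) → (x0 + x ≤ᵇ p) ∧ d0 c ## D) Lp

      d2∈seconds : (x2 , d2 c) ∈ seconds
      d2∈seconds = ∈-filterᵇ {q = λ (x , D) → (x1 + x ≤ᵇ p) ∧ d1 c ## D} d2∈Lp
        (∧-T {x1 + x2 ≤ᵇ p} (≤⇒≤ᵇ w12) (Apart⇒## (d1 c) (d2 c) (c12 c)))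

      d4∈lasts : (x4 , d4 c) ∈ lasts
      d4∈lasts = ∈-filterᵇ {q = λ (x , D) → (x0 + x ≤ᵇ p) ∧ d0 c ## D} d4∈Lp
        (∧-T {x0 + x4 ≤ᵇ p} (≤⇒≤ᵇ (≤-trans (≤-reflexive (+-comm x0 x4)) w40))
          (Apart⇒## (d0 c) (d4 c) (Apart-sym (d4 c) (d0 c) (c40 c))))

      -- The pair of the last and the first slice is not heavier than the leading pair. This
      -- justifies the early test in `fourth`.
      x4≤x1 : x4 ≤ x1
      x4≤x1 = +-cancelˡ-≤ x0 x4 x1 (≤-trans (≤-reflexive (+-comm x0 x4)) w40)

      s : ℕ
      s = profit (d0 c) + profit (d1 c)

      third-checked : T (third Lp lasts p (p + x1) s (x2 , d2 c))
      third-checked = ∈-all {p = third Lp lasts p (p + x1) s} (T-∧ʳ {t + 2 * p ≤ᵇ R} checked) d2∈seconds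

      fourth-checked : T (all (fifth (p + x2 + x3) (s + profit (d2 c) + profit (d3 c)) (d3 c)) lasts)
      fourth-checked = ⇒-elim
        (∈-all {p = fourth lasts p (p + x1 + x2) s (x2 , d2 c)} third-checked d3∈Lp)
        (∧-T {R ≤ᵇ p + x1 + x2 + x3} (≤⇒≤ᵇ (begin
          R                       ≤⟨ R≤total c ⟩
          p + x2 + x3 + x4        ≤⟨ +-monoʳ-≤ (p + x2 + x3) x4≤x1 ⟩
          p + x2 + x3 + x1        ≡⟨ regroup p x1 x2 x3 ⟩
          p + x1 + x2 + x3        ∎))
        (∧-T {x2 + x3 ≤ᵇ p} (≤⇒≤ᵇ w23) (Apart⇒## (d2 c) (d3 c) (c23 c))))
        where
        regroup : ∀ p b c d → p + c + d + b ≡ p + b + c + d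
        regroup = solve-∀

      absurd : ⊥
      absurd = <⇒≱ (<ᵇ⇒< _ need (⇒-elim
        (∈-all {p = fifth (p + x2 + x3) (s + profit (d2 c) + profit (d3 c)) (d3 c)}
          fourth-checked d4∈lasts)
        (∧-T {R ≤ᵇ p + x2 + x3 + x4} (≤⇒≤ᵇ (R≤total c)) (Apart⇒## (d3 c) (d4 c) (c34 c)))))
        (heavy c)

    rotations : Cycle H need → List (Cycle H need)
    rotations c = rotate c ∷ rotate (rotate c) ∷ rotate (rotate (rotate c)) ∷
                  rotate (rotate (rotate (rotate c))) ∷ []

    within-rotations : ∀ {p} c → Within p c → All (Within p) (rotations c)
    within-rotations c w₀ = w₁ ∷ w₂ ∷ w₃ ∷ within-rotate (rotate (rotate (rotate c))) w₃ ∷ []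
      where
      w₁ = within-rotate c w₀
      w₂ = within-rotate (rotate c) w₁
      w₃ = within-rotate (rotate (rotate c)) w₂

    pairs-within : ∀ {p} c → All (λ c′ → pair c′ ≤ p) (c ∷ rotations c) → Within p c
    pairs-within c (p₀ ∷ p₁ ∷ p₂ ∷ p₃ ∷ p₄ ∷ []) = p₀ , p₁ , p₂ , p₃ , p₄

    -- The five consecutive pairs are the leading pairs of the cycle and its rotations, so a
    -- rotation with greatest leading pair bounds them all.
    best-pair-first : Cycle H need → ∃ λ c → Within (pair c) c
    best-pair-first c = first-of (greatest pair c (rotations c))
      where
      first-of : (∃ λ b → b ∈ c ∷ rotations c × All (λ c′ → pair c′ ≤ pair b) (c ∷ rotations c)) →
                 ∃ λ c → Within (pair c) c
      first-of (b , b∈ , b-greatest) = b , All.lookup (within-c ∷ within-rotations c within-c) b∈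
        where
        within-c : Within (pair b) c
        within-c = pairs-within c b-greatest

    no-cycle : Cycle H need → ⊥
    no-cycle c = impossible (best-pair-first c)
      where
      impossible : (∃ λ c → Within (pair c) c) → ⊥
      impossible (b , within) =
        [ absurd b within
        -- If `d1` is the heavier, the cycle is read in reverse; its leading pair is the same up to
        -- order.
        , absurd (reflect b) (subst (λ p → Within p (reflect b))
            (+-comm (value (d0 b)) (value (d1 b))) (within-reflect b within))
        ]′ (≤-total (value (d1 b)) (value (d0 b)))

-- Descent to minimal codes and the bound for six slices

minimal-or-smaller : ∀ n H (σs : List Symmetry) →
  T (all (λ σ → n ≤ᵇ code (map-slice σ H)) σs) ⊎ ∃ λ σ → code (map-slice σ H) < n
minimal-or-smaller n H []       = inj₁ tt
minimal-or-smaller n H (σ ∷ σs) with ≤-<-connex n (code (map-slice σ H))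
... | inj₂ σ< = inj₂ (σ , σ<)
... | inj₁ n≤ = map₁ (∧-T {n ≤ᵇ code (map-slice σ H)} (≤⇒≤ᵇ n≤)) (minimal-or-smaller n H σs)

-- Well-founded descent on the code: a hub slice of minimal code is covered by `all-refuted`, and
-- any other is moved, together with its cycle, by a symmetry that lowers the code.
no-cycle : ∀ H → Acc _<_ (code H) → Stable H → 59 ≤ cost H → Cycle H (demand (cost H)) → ⊥
no-cycle H (acc smaller) s 59≤ c = [ at-minimum , by-symmetry ]′
  (minimal-or-smaller (code H) H symmetries)
  where
  costs≤16 : ∀ (k l : Line) → wt 8 7 l ≤ 16
  costs≤16 k l = ≤ᵇ⇒≤ (wt 8 7 l) 16 (∀line (λ l → wt 8 7 l ≤ᵇ 16) tt l)

  at-minimum : T (minimal (code H) H) → ⊥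
  at-minimum m = Soundness.no-cycle H (demand (cost H))
    (⇒-elim {minimal (code H) H} (∈-all {p = refuted} (Equivalence.from T-≡ all-refuted)
      (Costs.∈-search costs≤16 59 empty empty H s (Apart-empty H) 59≤)) m) c

  by-symmetry : (∃ λ σ → code (map-slice σ H) < code H) → ⊥
  by-symmetry (σ , σ<) = no-cycle (map-slice σ H) (smaller σ<) (stable σ H s)
    (≤-trans 59≤ (≤-reflexive (sym (same-cost σ H))))
    (subst (Cycle (map-slice σ H)) (cong demand (sym (same-cost σ H))) (transport σ c))

slices-bound : ∀ H D0 D1 D2 D3 D4 →
  Stable H → Stable D0 → Stable D1 → Stable D2 → Stable D3 → Stable D4 →
  Apart D0 H → Apart D1 H → Apart D2 H → Apart D3 H → Apart D4 H →
  Apart D0 D1 → Apart D1 D2 → Apart D2 D3 → Apart D3 D4 → Apart D4 D0 →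
  cost H + 2 * sum₅ (profit D0) (profit D1) (profit D2) (profit D3) (profit D4) ≤ 378
slices-bound H D0 D1 D2 D3 D4 s s0 s1 s2 s3 s4 h0 h1 h2 h3 h4 c01 c12 c23 c34 c40 =
  ≤-pred (≰⇒> λ 379≤ → no-cycle H (<-wellFounded (code H)) s (59≤cost 379≤) record
    { d0 = D0 ; d1 = D1 ; d2 = D2 ; d3 = D3 ; d4 = D4
    ; s0 = s0 ; s1 = s1 ; s2 = s2 ; s3 = s3 ; s4 = s4
    ; h0 = h0 ; h1 = h1 ; h2 = h2 ; h3 = h3 ; h4 = h4
    ; c01 = c01 ; c12 = c12 ; c23 = c23 ; c34 = c34 ; c40 = c40
    ; heavy = demand≤ 379≤
    })
  where
  open ≤-Reasoning

  Σ : ℕ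
  Σ = sum₅ (profit D0) (profit D1) (profit D2) (profit D3) (profit D4)

  59≤cost : 379 ≤ cost H + 2 * Σ → 59 ≤ cost H
  -- Five slices of profit at most 32 contribute at most 320 after doubling.
  59≤cost 379≤ = +-cancelʳ-≤ 320 59 (cost H) (≤-trans 379≤ (+-monoʳ-≤ (cost H) (*-monoʳ-≤ 2
    (sum₅-mono (profit≤32 D0 s0) (profit≤32 D1 s1) (profit≤32 D2 s2) (profit≤32 D3 s3)
               (profit≤32 D4 s4)))))

  demand≤ : 379 ≤ cost H + 2 * Σ → demand (cost H) ≤ Σ
  demand≤ 379≤ = begin
    -- Starting from 380 instead of 379 makes the halving round up.
    ⌊ 380 ∸ cost H /2⌋  ≤⟨ ⌊n/2⌋-mono (m≤n+o⇒m∸n≤o 380 (cost H) (begin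
      380                       ≤⟨ s≤s 379≤ ⟩
      suc (cost H + 2 * Σ)      ≡⟨ +-suc (cost H) (2 * Σ) ⟨
      cost H + suc (2 * Σ)      ≡⟨ cong (λ n → cost H + suc (Σ + n)) (+-identityʳ Σ) ⟩
      cost H + suc (Σ + Σ)      ∎)) ⟩
    ⌊ suc (Σ + Σ) /2⌋   ≡⟨ n≡⌈n+n/2⌉ Σ ⟨
    Σ                   ∎

-- Sums over the vertices of a graph

open Graph using (V; vertex; index; enumeration)

∑ : (G : Graph) → (V G → ℕ) → ℕ
∑ G h = sum (h ∘ vertex G)

sum-mono : ∀ {n} {f g : Fin n → ℕ} → (∀ i → f i ≤ g i) → sum f ≤ sum g
sum-mono {zero}  f≤g = z≤n
sum-mono {suc n} f≤g = +-mono-≤ (f≤g zero) (sum-mono (f≤g ∘ suc))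

sum-const : ∀ n c → sum {n} (λ _ → c) ≡ n * c
sum-const zero    c = refl
sum-const (suc n) c = cong (c +_) (sum-const n c)

module _ (G : Graph) where

  ∑-cong : {h k : V G → ℕ} → (∀ x → h x ≡ k x) → ∑ G h ≡ ∑ G k
  ∑-cong h≡k = sum-cong-≗ (h≡k ∘ vertex G)

  ∑-mono : {h k : V G → ℕ} → (∀ x → h x ≤ k x) → ∑ G h ≤ ∑ G k
  ∑-mono h≤k = sum-mono (h≤k ∘ vertex G)

  ∑-+ : (h k : V G → ℕ) → ∑ G (λ x → h x + k x) ≡ ∑ G h + ∑ G k
  ∑-+ h k = ∑-distrib-+ (h ∘ vertex G) (k ∘ vertex G)

  ∑-* : ∀ c (h : V G → ℕ) → ∑ G (λ x → c * h x) ≡ c * ∑ G h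
  ∑-* c h = sym (*-distribˡ-sum c (h ∘ vertex G))

  ∑-const : ∀ c → ∑ G (λ _ → c) ≡ order G * c
  ∑-const c = sum-const (order G) c

  ∣∣≡∑ : (S : Subset (order G)) → ∣ S ∣ ≡ ∑ G (λ v → bit (lookup S (index G v)))
  ∣∣≡∑ S = trans (∣∣≡sum S) (sum-cong-≗ λ i →
    cong (bit ∘ lookup S) (sym (Inverse.strictlyInverseˡ (enumeration G) i)))

∑-swap : ∀ G H (h : V G → V H → ℕ) → ∑ G (λ x → ∑ H (h x)) ≡ ∑ H (λ y → ∑ G (λ x → h x y))
∑-swap G H h = ∑-comm (λ i j → h (vertex G i) (vertex H j))

∑-□ : ∀ G H (h : V (G □ H) → ℕ) → ∑ (G □ H) h ≡ ∑ G (λ x → ∑ H (λ y → h (x , y)))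
∑-□ G H h = trans (sum-combine (order G) (h ∘ vertex (G □ H)))
  (sum-cong-≗ λ i → sum-cong-≗ λ j → cong (λ (k , l) → h (vertex G k , vertex H l))
    (remQuot-combine {order G} {order H} i j))

-- The weights on W₅ □ W₅ □ W₅

-- With a characteristic function in place of a set of indices, passing to a section of a product is
-- mere composition.
IndependentIn : (G : Graph) → (V G → Bool) → Set
IndependentIn G f = ∀ u v → f u ≡ true → f v ≡ true → ¬ (Graph._~_ G u v)

Cube : Graph
Cube = W₅ □ W₅ □ W₅

cell : ℕ → ℕ → V W₅ → ℕ
cell r s (inj₁ _) = r
cell r s (inj₂ _) = s

ω : V Cube → ℕ
ω ((inj₁ _ , inj₁ _) , c) = cell 6 8 c
ω ((inj₁ _ , inj₂ _) , c) = cell 8 4 c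
ω ((inj₂ _ , inj₁ _) , c) = cell 8 7 c
ω ((inj₂ _ , inj₂ _) , c) = cell 7 4 c

∑ω : ∑ Cube ω ≡ 1444
∑ω = refl

∑ω² : ∑ Cube (λ y → ω y * ω y) ≡ 9886
∑ω² = refl

at : Pt → V W₅
at v0  = inj₁ 0F
at v1  = inj₁ 1F
at v2  = inj₁ 2F
at v3  = inj₁ 3F
at v4  = inj₁ 4F
at hub = inj₂ 0F

every : ∀ n → (Vec Bool n → Bool) → Bool
every zero    p = p []
every (suc n) p = every n (p ∘ (true ∷_)) ∧ every n (p ∘ (false ∷_))

every-sound : ∀ {n} {p : Vec Bool n → Bool} → T (every n p) → ∀ v → T (p v)
every-sound           h []          = h
every-sound {p = p}   h (true ∷ v)  = every-sound (T-∧ˡ h) v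
every-sound {suc n} {p} h (false ∷ v) = every-sound (T-∧ʳ {every n (p ∘ (true ∷_))} h) v

-- Earlier clauses take precedence, so an independent row yields exactly its own line. On any other
-- row the result is some line contained in it, whence `choose-⊆` holds without hypothesis.
choose : Vec Bool 6 → Line
choose (_    ∷ _    ∷ _    ∷ _    ∷ _    ∷ true ∷ []) = ★
choose (true ∷ _    ∷ true ∷ _    ∷ _    ∷ _    ∷ []) = b0
choose (true ∷ _    ∷ _    ∷ true ∷ _    ∷ _    ∷ []) = b3
choose (_    ∷ true ∷ _    ∷ true ∷ _    ∷ _    ∷ []) = b1
choose (_    ∷ true ∷ _    ∷ _    ∷ true ∷ _    ∷ []) = b4
choose (_    ∷ _    ∷ true ∷ _    ∷ true ∷ _    ∷ []) = b2
choose (true ∷ _    ∷ _    ∷ _    ∷ _    ∷ _    ∷ []) = a0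
choose (_    ∷ true ∷ _    ∷ _    ∷ _    ∷ _    ∷ []) = a1
choose (_    ∷ _    ∷ true ∷ _    ∷ _    ∷ _    ∷ []) = a2
choose (_    ∷ _    ∷ _    ∷ true ∷ _    ∷ _    ∷ []) = a3
choose (_    ∷ _    ∷ _    ∷ _    ∷ true ∷ _    ∷ []) = a4
choose (_    ∷ _    ∷ _    ∷ _    ∷ _    ∷ _    ∷ []) = ∅

bit-at : Vec Bool 6 → Pt → Bool
bit-at (a ∷ b ∷ c ∷ d ∷ e ∷ h ∷ []) v0  = a
bit-at (a ∷ b ∷ c ∷ d ∷ e ∷ h ∷ []) v1  = b
bit-at (a ∷ b ∷ c ∷ d ∷ e ∷ h ∷ []) v2  = c
bit-at (a ∷ b ∷ c ∷ d ∷ e ∷ h ∷ []) v3  = d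
bit-at (a ∷ b ∷ c ∷ d ∷ e ∷ h ∷ []) v4  = e
bit-at (a ∷ b ∷ c ∷ d ∷ e ∷ h ∷ []) hub = h

disjoint : Bool → Bool → Bool
disjoint x y = not (x ∧ y)

independent : Vec Bool 6 → Bool
independent (a ∷ b ∷ c ∷ d ∷ e ∷ h ∷ []) =
  disjoint a b ∧ disjoint b c ∧ disjoint c d ∧ disjoint d e ∧ disjoint e a ∧
  disjoint a h ∧ disjoint b h ∧ disjoint c h ∧ disjoint d h ∧ disjoint e h

-- The form to which the sum over `W₅` in `line-weight` unfolds.
total : ℕ → ℕ → Vec Bool 6 → ℕ
total r s (a ∷ b ∷ c ∷ d ∷ e ∷ h ∷ []) =
  r * bit a + (r * bit b + (r * bit c + (r * bit d + (r * bit e + (s * bit h + 0)))))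

choose-⊆ : ∀ v p → T (bit-at v p ∨ choose v ∌ p)
choose-⊆ v p = ∈-all {p = kept v} (every-sound {p = λ v → all (kept v) pts} tt v) (∈-pts p)
  where
  kept : Vec Bool 6 → Pt → Bool
  kept v p = bit-at v p ∨ choose v ∌ p

  ∈-pts : ∀ p → p ∈ pts
  ∈-pts v0  = here refl
  ∈-pts v1  = there (here refl)
  ∈-pts v2  = there (there (here refl))
  ∈-pts v3  = there (there (there (here refl)))
  ∈-pts v4  = there (there (there (there (here refl))))
  ∈-pts hub = there (there (there (there (there (here refl)))))

Tight : ℕ → ℕ → Set
Tight r s = T (every 6 λ v → independent v ⇒ (total r s v ≤ᵇ wt r s (choose v)))

module _ (g : V W₅ → Bool) where

  row : Vec Bool 6
  row = g (at v0) ∷ g (at v1) ∷ g (at v2) ∷ g (at v3) ∷ g (at v4) ∷ g (at hub) ∷ []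

  line : Line
  line = choose row

  bit-at-row : ∀ p → bit-at row p ≡ g (at p)
  bit-at-row v0  = refl
  bit-at-row v1  = refl
  bit-at-row v2  = refl
  bit-at-row v3  = refl
  bit-at-row v4  = refl
  bit-at-row hub = refl

  line-∌ : ∀ p → g (at p) ≡ false → T (line ∌ p)
  line-∌ p gp with choose-⊆ row p
  ... | h rewrite bit-at-row p | gp = h

  line-weight : ∀ r s → Tight r s → IndependentIn W₅ g →
                ∑ W₅ (λ c → cell r s c * bit (g c)) ≤ wt r s line
  line-weight r s tight ind = ≤ᵇ⇒≤ _ _ (⇒-elim (every-sound
      {p = λ v → independent v ⇒ (total r s v ≤ᵇ wt r s (choose v))} tight row)
    (∧-T (not-both v0 v1 (inj₁ refl)) (∧-T (not-both v1 v2 (inj₁ refl)) (∧-T (not-both v2 v3 (inj₁ refl))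
    (∧-T (not-both v3 v4 (inj₁ refl)) (∧-T (not-both v4 v0 (inj₁ refl)) (∧-T (not-both v0 hub tt)
    (∧-T (not-both v1 hub tt) (∧-T (not-both v2 hub tt) (∧-T (not-both v3 hub tt) (not-both v4 hub tt)))))))))))
    where
    not-both : ∀ p q → Graph._~_ W₅ (at p) (at q) → T (disjoint (g (at p)) (g (at q)))
    not-both p q p~q with g (at p) in gp | g (at q) in gq
    ... | true  | true  = ind (at p) (at q) gp gq p~q
    ... | true  | false = tt
    ... | false | _     = tt

lines-apart : ∀ g h → (∀ v → g v ≡ true → h v ≡ true → ⊥) → T (line g # line h)
lines-apart g h clash = ∌⇒# (line g) (line h) (all⁻ _ (All.universal misses pts))
  where
  misses : ∀ p → T (line g ∌ p ∨ line h ∌ p)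
  misses p with g (at p) in gp | h (at p) in hp
  ... | true  | true  = ⊥-elim (clash (at p) gp hp)
  ... | false | _     = Equivalence.from T-∨ (inj₁ (line-∌ g p gp))
  ... | true  | false = Equivalence.from (T-∨ {line g ∌ p}) (inj₂ (line-∌ h p hp))

module _ (f : V Cube → Bool) (ind : IndependentIn Cube f) where

  private
    along : V W₅ → V W₅ → V W₅ → Bool
    along a b c = f ((a , b) , c)

    line-at : V W₅ → V W₅ → Line
    line-at a b = line (along a b)

    slice-at : V W₅ → Slice
    slice-at a = slice (line-at a (at v0)) (line-at a (at v1)) (line-at a (at v2))
                       (line-at a (at v3)) (line-at a (at v4)) (line-at a (at hub))

    along-independent : ∀ a b → IndependentIn W₅ (along a b)
    along-independent a b c c′ fc fc′ c~c′ =
      ind ((a , b) , c) ((a , b) , c′) fc fc′ (inj₁ (refl , c~c′))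

    rows-apart : ∀ a p q → Graph._~_ W₅ (at p) (at q) → T (line-at a (at p) # line-at a (at q))
    rows-apart a p q p~q = lines-apart (along a (at p)) (along a (at q)) λ c fp fq →
      ind ((a , at p) , c) ((a , at q) , c) fp fq (inj₂ (refl , inj₁ (refl , p~q)))

    stable-at : ∀ a → Stable (slice-at a)
    stable-at a =
      (rows-apart a v1 v0 (inj₂ refl) , rows-apart a v2 v1 (inj₂ refl) ,
       rows-apart a v3 v2 (inj₂ refl) , rows-apart a v4 v3 (inj₂ refl) ,
       rows-apart a v4 v0 (inj₁ refl)) ,
      (rows-apart a v0 hub tt , rows-apart a v1 hub tt , rows-apart a v2 hub tt ,
       rows-apart a v3 hub tt , rows-apart a v4 hub tt)

    apart-at : ∀ a a′ → Graph._~_ W₅ a a′ → Apart (slice-at a) (slice-at a′)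
    apart-at a a′ a~a′ = at-row v0 , at-row v1 , at-row v2 , at-row v3 , at-row v4 , at-row hub
      where
      at-row : ∀ p → T (line-at a (at p) # line-at a′ (at p))
      at-row p = lines-apart (along a (at p)) (along a′ (at p)) λ c fa fa′ →
        ind ((a , at p) , c) ((a′ , at p) , c) fa fa′ (inj₂ (refl , inj₂ (refl , a~a′)))

    slice-weight : V W₅ → ℕ
    slice-weight a = ∑ W₅ λ b → ∑ W₅ λ c → ω ((a , b) , c) * bit (along a b c)

    -- The order in which the sum over `W₅` unfolds; `weight` takes the rim rows in the opposite
    -- order.
    ascending : ℕ → ℕ → ℕ → ℕ → Slice → ℕ
    ascending r s r′ s′ (slice a b c d e h) =
      wt r s a + (wt r s b + (wt r s c + (wt r s d + (wt r s e + (wt r′ s′ h + 0)))))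

    ascending≡ : ∀ r s r′ s′ D → ascending r s r′ s′ D ≡ weight (λ _ → wt r s) (wt r′ s′) empty D
    ascending≡ r s r′ s′ (slice a b c d e h) =
      reverse (wt r s a) (wt r s b) (wt r s c) (wt r s d) (wt r s e) (wt r′ s′ h + 0)
      where
      reverse : ∀ a b c d e h →
        a + (b + (c + (d + (e + h)))) ≡ e + (d + (c + (b + (a + h))))
      reverse = solve-∀

    rim-slice : ∀ i → slice-weight (inj₁ i) ≤ 2 * profit (slice-at (inj₁ i))
    rim-slice i = ≤-trans
      (+-mono-≤ (rim v0) (+-mono-≤ (rim v1) (+-mono-≤ (rim v2) (+-mono-≤ (rim v3)
        (+-mono-≤ (rim v4) (+-monoˡ-≤ 0 (line-weight _ 8 4 tt (along-independent a (at hub)))))))))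
      (≤-reflexive (trans (ascending≡ 6 8 8 4 (slice-at a)) (weight-double 3 4 4 2 (slice-at a))))
      where
      a : V W₅
      a = inj₁ i
      rim : ∀ p → ∑ W₅ (λ c → cell 6 8 c * bit (along a (at p) c)) ≤ wt 6 8 (line-at a (at p))
      rim p = line-weight _ 6 8 tt (along-independent a (at p))

    hub-slice : ∀ i → slice-weight (inj₂ i) ≤ cost (slice-at (inj₂ i))
    hub-slice i = ≤-trans
      (+-mono-≤ (rim v0) (+-mono-≤ (rim v1) (+-mono-≤ (rim v2) (+-mono-≤ (rim v3)
        (+-mono-≤ (rim v4) (+-monoˡ-≤ 0 (line-weight _ 7 4 tt (along-independent a (at hub)))))))))
      (≤-reflexive (ascending≡ 8 7 7 4 (slice-at a)))
      where
      a : V W₅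
      a = inj₂ i
      rim : ∀ p → ∑ W₅ (λ c → cell 8 7 c * bit (along a (at p) c)) ≤ wt 8 7 (line-at a (at p))
      rim p = line-weight _ 8 7 tt (along-independent a (at p))

  cube-bound : ∑ Cube (λ y → ω y * bit (f y)) ≤ 378
  cube-bound = begin
    ∑ Cube (λ y → ω y * bit (f y))
      ≡⟨ ∑-□ (W₅ □ W₅) W₅ (λ y → ω y * bit (f y)) ⟩
    ∑ (W₅ □ W₅) (λ x → ∑ W₅ λ c → ω (x , c) * bit (f (x , c)))
      ≡⟨ ∑-□ W₅ W₅ (λ x → ∑ W₅ λ c → ω (x , c) * bit (f (x , c))) ⟩
    ∑ W₅ slice-weight
      ≤⟨ +-mono-≤ (rim-slice _) (+-mono-≤ (rim-slice _) (+-mono-≤ (rim-slice _)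
        (+-mono-≤ (rim-slice _) (+-mono-≤ (rim-slice _) (+-monoˡ-≤ 0 (hub-slice _)))))) ⟩
    _ ≡⟨ collect (profit (D v0)) (profit (D v1)) (profit (D v2)) (profit (D v3)) (profit (D v4))
           (cost (D hub)) ⟩
    cost (D hub) + 2 * sum₅ (profit (D v0)) (profit (D v1)) (profit (D v2)) (profit (D v3))
                            (profit (D v4))
      ≤⟨ slices-bound (D hub) (D v0) (D v1) (D v2) (D v3) (D v4)
           (stable-at _) (stable-at _) (stable-at _) (stable-at _) (stable-at _) (stable-at _)
           (apart-at (at v0) (at hub) tt) (apart-at (at v1) (at hub) tt)
           (apart-at (at v2) (at hub) tt) (apart-at (at v3) (at hub) tt)
           (apart-at (at v4) (at hub) tt)
           (apart-at (at v0) (at v1) (inj₁ refl)) (apart-at (at v1) (at v2) (inj₁ refl))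
           (apart-at (at v2) (at v3) (inj₁ refl)) (apart-at (at v3) (at v4) (inj₁ refl))
           (apart-at (at v4) (at v0) (inj₁ refl)) ⟩
    378 ∎
    where
    open ≤-Reasoning
    D : Pt → Slice
    D p = slice-at (at p)

    collect : ∀ a b c d e h →
      2 * a + (2 * b + (2 * c + (2 * d + (2 * e + (h + 0))))) ≡ h + 2 * (a + b + c + d + e)
    collect = solve-∀

-- The law of large numbers

2xy≤x²+y² : ∀ x y → 2 * (x * y) ≤ x * x + y * y
2xy≤x²+y² x y with ≤-total x y
... | inj₁ x≤y with k , refl ← m≤n⇒∃[o]m+o≡n x≤y = ≤-trans (m≤m+n _ (k * k)) (≤-reflexive (expand x k))
  where
  expand : ∀ x k → 2 * (x * (x + k)) + k * k ≡ x * x + (x + k) * (x + k)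
  expand = solve-∀
... | inj₂ y≤x with k , refl ← m≤n⇒∃[o]m+o≡n y≤x = ≤-trans (m≤m+n _ (k * k)) (≤-reflexive (expand y k))
  where
  expand : ∀ y k → 2 * ((y + k) * y) + k * k ≡ (y + k) * (y + k) + y * y
  expand = solve-∀

join : ∀ G → V G → V Cube → V (G □ W₅ □ W₅ □ W₅)
join G x ((a , b) , c) = ((x , a) , b) , c

∑-join : ∀ G (h : V (G □ W₅ □ W₅ □ W₅) → ℕ) →
         ∑ (G □ W₅ □ W₅ □ W₅) h ≡ ∑ G (λ x → ∑ Cube (λ y → h (join G x y)))
∑-join G h = begin
  ∑ (G □ W₅ □ W₅ □ W₅) h
    ≡⟨ ∑-□ (G □ W₅ □ W₅) W₅ h ⟩
  ∑ (G □ W₅ □ W₅) (λ z → ∑ W₅ λ c → h (z , c))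
    ≡⟨ ∑-□ (G □ W₅) W₅ (λ z → ∑ W₅ λ c → h (z , c)) ⟩
  ∑ (G □ W₅) (λ z → ∑ W₅ λ b → ∑ W₅ λ c → h ((z , b) , c))
    ≡⟨ ∑-□ G W₅ (λ z → ∑ W₅ λ b → ∑ W₅ λ c → h ((z , b) , c)) ⟩
  ∑ G (λ x → ∑ W₅ λ a → ∑ W₅ λ b → ∑ W₅ λ c → h (((x , a) , b) , c))
    ≡⟨ ∑-cong G (λ x → trans
         (∑-□ (W₅ □ W₅) W₅ (λ y → h (join G x y)))
         (∑-□ W₅ W₅ (λ z → ∑ W₅ λ c → h (join G x (z , c))))) ⟨
  ∑ G (λ x → ∑ Cube (λ y → h (join G x y)))
    ∎
  where open ≡-Reasoning

-- Powers start at exponent 1, so one coordinate precedes the `n` blocks, and `Z` gives it no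
-- weight. By definition `Power (suc n)` is `Power n □ W₅ □ W₅ □ W₅`.
Power : ℕ → Graph
Power n = W₅ ^□ suc (n * 3)

size : ℕ → ℕ
size n = order (Power n)

Z : ∀ n → V (Power n) → ℕ
Z zero    _                   = 0
Z (suc n) (((x , a) , b) , c) = Z n x + ω ((a , b) , c)

size-suc : ∀ n → size (suc n) ≡ size n * 216
size-suc n = trans (*-assoc (size n * 6) 6 6) (*-assoc (size n) 6 36)

-- With the constants as variables the computations become polynomial identities without large
-- numerals. `K` counts the vertices of a block, `W` and `Q` are the sums of the weights and of
-- their squares, `T` bounds the weight of an independent set.
module Moments (K W Q T : ℕ)
  (K≡ : order Cube ≡ K) (W≡ : ∑ Cube ω ≡ W) (Q≡ : ∑ Cube (λ y → ω y * ω y) ≡ Q)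
  (size-suc : ∀ n → size (suc n) ≡ size n * K)
  (T-bound : ∀ f → IndependentIn Cube f → ∑ Cube (λ y → ω y * bit (f y)) ≤ T)
  where

  ∑-constant : ∀ c → ∑ Cube (λ _ → c) ≡ K * c
  ∑-constant c = trans (∑-const Cube c) (cong (_* c) K≡)

  shifted : ∀ z → ∑ Cube (λ y → z + ω y) ≡ K * z + W
  shifted z = trans (∑-+ Cube (λ _ → z) ω) (cong₂ _+_ (∑-constant z) W≡)

  shifted² : ∀ z → ∑ Cube (λ y → (z + ω y) * (z + ω y)) ≡ K * (z * z) + (2 * W * z + Q)
  shifted² z = begin
    ∑ Cube (λ y → (z + ω y) * (z + ω y))
      ≡⟨ ∑-cong Cube (λ y → square z (ω y)) ⟩
    ∑ Cube (λ y → z * z + (2 * z * ω y + ω y * ω y))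
      ≡⟨ ∑-+ Cube (λ _ → z * z) (λ y → 2 * z * ω y + ω y * ω y) ⟩
    ∑ Cube (λ _ → z * z) + ∑ Cube (λ y → 2 * z * ω y + ω y * ω y)
      ≡⟨ cong₂ _+_ (∑-constant (z * z)) (∑-+ Cube (λ y → 2 * z * ω y) (λ y → ω y * ω y)) ⟩
    K * (z * z) + (∑ Cube (λ y → 2 * z * ω y) + ∑ Cube (λ y → ω y * ω y))
      ≡⟨ cong (K * (z * z) +_) (cong₂ _+_ (trans (∑-* Cube (2 * z) ω) (cong (2 * z *_) W≡)) Q≡) ⟩
    K * (z * z) + (2 * z * W + Q)
      ≡⟨ cong (λ m → K * (z * z) + (m + Q)) (regroup z W) ⟩
    K * (z * z) + (2 * W * z + Q)
      ∎
    where
    open ≡-Reasoning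
    square : ∀ z w → (z + w) * (z + w) ≡ z * z + (2 * z * w + w * w)
    square = solve-∀
    regroup : ∀ z w → 2 * z * w ≡ 2 * w * z
    regroup = solve-∀

  ∑Z ∑Z² : ℕ → ℕ
  ∑Z  n = ∑ (Power n) (Z n)
  ∑Z² n = ∑ (Power n) (λ x → Z n x * Z n x)

  ∑Z-suc : ∀ n → ∑Z (suc n) ≡ K * ∑Z n + size n * W
  ∑Z-suc n = begin
    ∑Z (suc n)
      ≡⟨ ∑-join (Power n) (Z (suc n)) ⟩
    ∑ (Power n) (λ x → ∑ Cube (λ y → Z n x + ω y))
      ≡⟨ ∑-cong (Power n) (λ x → shifted (Z n x)) ⟩
    ∑ (Power n) (λ x → K * Z n x + W)
      ≡⟨ ∑-+ (Power n) (λ x → K * Z n x) (λ _ → W) ⟩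
    ∑ (Power n) (λ x → K * Z n x) + ∑ (Power n) (λ _ → W)
      ≡⟨ cong₂ _+_ (∑-* (Power n) K (Z n)) (∑-const (Power n) W) ⟩
    K * ∑Z n + size n * W
      ∎
    where open ≡-Reasoning

  ∑Z²-suc : ∀ n → ∑Z² (suc n) ≡ K * ∑Z² n + (2 * W * ∑Z n + size n * Q)
  ∑Z²-suc n = begin
    ∑Z² (suc n)
      ≡⟨ ∑-join (Power n) (λ x → Z (suc n) x * Z (suc n) x) ⟩
    ∑ (Power n) (λ x → ∑ Cube (λ y → (Z n x + ω y) * (Z n x + ω y)))
      ≡⟨ ∑-cong (Power n) (λ x → shifted² (Z n x)) ⟩
    ∑ (Power n) (λ x → K * (Z n x * Z n x) + (2 * W * Z n x + Q))
      ≡⟨ ∑-+ (Power n) (λ x → K * (Z n x * Z n x)) (λ x → 2 * W * Z n x + Q) ⟩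
    ∑ (Power n) (λ x → K * (Z n x * Z n x)) + ∑ (Power n) (λ x → 2 * W * Z n x + Q)
      ≡⟨ cong₂ _+_ (∑-* (Power n) K (λ x → Z n x * Z n x)) (trans
           (∑-+ (Power n) (λ x → 2 * W * Z n x) (λ _ → Q))
           (cong₂ _+_ (∑-* (Power n) (2 * W) (Z n)) (∑-const (Power n) Q))) ⟩
    K * ∑Z² n + (2 * W * ∑Z n + size n * Q)
      ∎
    where open ≡-Reasoning

  mean : ∀ n → K * ∑Z n ≡ n * W * size n
  mean zero    = *-zeroʳ K
  mean (suc n) = begin
    K * ∑Z (suc n)                       ≡⟨ cong (K *_) (∑Z-suc n) ⟩
    K * (K * ∑Z n + size n * W)          ≡⟨ cong (λ m → K * (m + size n * W)) (mean n) ⟩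
    K * (n * W * size n + size n * W)    ≡⟨ regroup K W n (size n) ⟩
    (1 + n) * W * (size n * K)           ≡⟨ cong ((1 + n) * W *_) (size-suc n) ⟨
    suc n * W * size (suc n)             ∎
    where
    open ≡-Reasoning
    regroup : ∀ K W n s → K * (n * W * s + s * W) ≡ (1 + n) * W * (s * K)
    regroup = solve-∀

  -- The variance is n (K Q ∸ W²) / K²; the subtracted term is moved to the left.
  second-moment : ∀ n → K * K * ∑Z² n + size n * (n * (W * W)) ≡
                        size n * (n * W * (n * W) + n * (K * Q))
  second-moment zero    = trans (+-identityʳ _) (*-zeroʳ (K * K))
  second-moment (suc n) = begin
    K * K * ∑Z² (suc n) + size (suc n) * (suc n * (W * W))
      ≡⟨ cong₂ (λ m s → K * K * m + s * (suc n * (W * W))) (∑Z²-suc n) (size-suc n) ⟩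
    K * K * (K * ∑Z² n + (2 * W * ∑Z n + size n * Q)) + size n * K * ((1 + n) * (W * W))
      ≡⟨ expand K W Q n (size n) (∑Z n) (∑Z² n) ⟩
    K * (K * K * ∑Z² n + size n * (n * (W * W))) +
      (2 * W * K * (K * ∑Z n) + size n * K * (K * Q + W * W))
      ≡⟨ cong₂ (λ m k → K * m + (2 * W * K * k + size n * K * (K * Q + W * W)))
           (second-moment n) (mean n) ⟩
    K * (size n * (n * W * (n * W) + n * (K * Q))) +
      (2 * W * K * (n * W * size n) + size n * K * (K * Q + W * W))
      ≡⟨ regroup K W Q n (size n) ⟩
    size n * K * ((1 + n) * W * ((1 + n) * W) + (1 + n) * (K * Q))
      ≡⟨ cong (_* (suc n * W * (suc n * W) + suc n * (K * Q))) (size-suc n) ⟨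
    size (suc n) * (suc n * W * (suc n * W) + suc n * (K * Q))
      ∎
    where
    open ≡-Reasoning
    expand : ∀ K W Q n s z z² →
      K * K * (K * z² + (2 * W * z + s * Q)) + s * K * ((1 + n) * (W * W)) ≡
      K * (K * K * z² + s * (n * (W * W))) + (2 * W * K * (K * z) + s * K * (K * Q + W * W))
    expand = solve-∀
    regroup : ∀ K W Q n s →
      K * (s * (n * W * (n * W) + n * (K * Q))) + (2 * W * K * (n * W * s) + s * K * (K * Q + W * W)) ≡
      s * K * ((1 + n) * W * ((1 + n) * W) + (1 + n) * (K * Q))
    regroup = solve-∀

  -- Induction on the blocks: with the last block fixed, the section is independent in `Power n`;
  -- with the other coordinates fixed, it is independent in `Cube`, where `T-bound` applies.
  weighted-bound : ∀ n (f : V (Power n) → Bool) → IndependentIn (Power n) f →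
                   K * ∑ (Power n) (λ x → Z n x * bit (f x)) ≤ n * T * size n
  weighted-bound zero    f ind = ≤-reflexive (*-zeroʳ K)
  weighted-bound (suc n) f ind = begin
    K * ∑ (Power (suc n)) (λ x → Z (suc n) x * bit (f x))
      ≡⟨ cong (K *_) (∑-join G (λ x → Z (suc n) x * bit (f x))) ⟩
    K * ∑ G (λ x → ∑ Cube (λ y → (Z n x + ω y) * b x y))
      ≡⟨ cong (K *_) (∑-cong G (λ x → trans
           (∑-cong Cube (λ y → *-distribʳ-+ (b x y) (Z n x) (ω y)))
           (∑-+ Cube (λ y → Z n x * b x y) (λ y → ω y * b x y)))) ⟩
    K * ∑ G (λ x → ∑ Cube (λ y → Z n x * b x y) + ∑ Cube (λ y → ω y * b x y))
      ≡⟨ cong (K *_) (∑-+ G (λ x → ∑ Cube (λ y → Z n x * b x y))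
                            (λ x → ∑ Cube (λ y → ω y * b x y))) ⟩
    K * (∑ G (λ x → ∑ Cube (λ y → Z n x * b x y)) + ∑ G (λ x → ∑ Cube (λ y → ω y * b x y)))
      ≡⟨ *-distribˡ-+ K (∑ G (λ x → ∑ Cube (λ y → Z n x * b x y)))
                        (∑ G (λ x → ∑ Cube (λ y → ω y * b x y))) ⟩
    K * ∑ G (λ x → ∑ Cube (λ y → Z n x * b x y)) + K * ∑ G (λ x → ∑ Cube (λ y → ω y * b x y))
      ≤⟨ +-mono-≤ inherited (*-monoʳ-≤ K gained) ⟩
    K * (n * T * size n) + K * (size n * T)
      ≡⟨ regroup K T n (size n) ⟩
    (1 + n) * T * (size n * K)
      ≡⟨ cong ((1 + n) * T *_) (size-suc n) ⟨
    suc n * T * size (suc n)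
      ∎
    where
    open ≤-Reasoning
    G : Graph
    G = Power n

    b : V G → V Cube → ℕ
    b x y = bit (f (join G x y))

    across : ∀ y → IndependentIn G (λ x → f (join G x y))
    across y@((_ , _) , _) u v fu fv u~v = ind (join G u y) (join G v y) fu fv
      (inj₂ (refl , inj₂ (refl , inj₂ (refl , u~v))))

    within : ∀ x → IndependentIn Cube (λ y → f (join G x y))
    within x u v fu fv u~v = ind (join G x u) (join G x v) fu fv (lift u v u~v)
      where
      lift : ∀ u v → Graph._~_ Cube u v → Graph._~_ (Power (suc n)) (join G x u) (join G x v)
      lift ((_ , _) , _) ((_ , _) , _) (inj₁ (refl , e))               = inj₁ (refl , e)
      lift ((_ , _) , _) ((_ , _) , _) (inj₂ (refl , inj₁ (refl , e))) =
        inj₂ (refl , inj₁ (refl , e))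
      lift ((_ , _) , _) ((_ , _) , _) (inj₂ (refl , inj₂ (refl , e))) =
        inj₂ (refl , inj₂ (refl , inj₁ (refl , e)))

    inherited : K * ∑ G (λ x → ∑ Cube (λ y → Z n x * b x y)) ≤ K * (n * T * size n)
    inherited = begin
      K * ∑ G (λ x → ∑ Cube (λ y → Z n x * b x y))
        ≡⟨ cong (K *_) (∑-swap G Cube (λ x y → Z n x * b x y)) ⟩
      K * ∑ Cube (λ y → ∑ G (λ x → Z n x * b x y))
        ≡⟨ ∑-* Cube K (λ y → ∑ G (λ x → Z n x * b x y)) ⟨
      ∑ Cube (λ y → K * ∑ G (λ x → Z n x * b x y))
        ≤⟨ ∑-mono Cube (λ y → weighted-bound n (λ x → f (join G x y)) (across y)) ⟩
      ∑ Cube (λ _ → n * T * size n)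
        ≡⟨ ∑-constant (n * T * size n) ⟩
      K * (n * T * size n)
        ∎

    gained : ∑ G (λ x → ∑ Cube (λ y → ω y * b x y)) ≤ size n * T
    gained = ≤-trans (∑-mono G (λ x → T-bound (λ y → f (join G x y)) (within x)))
                     (≤-reflexive (∑-const G T))

    regroup : ∀ K T n s → K * (n * T * s) + K * (s * T) ≡ (1 + n) * T * (s * K)
    regroup = solve-∀

  module _ (n d : ℕ) (f : V (Power n) → Bool) (ind : IndependentIn (Power n) f) where

    private
      G : Graph
      G = Power n

      E : ℕ
      E = n * W

    -- Let E be the mean of K Z. If (E ∸ K z ∸ d)² ≥ 0 is used for a vertex in the set and
    -- (E ∸ K z)² ≥ 0 for one outside, moving all terms leaves no subtraction.
    pointwise : ∀ z β → 2 * d * E * bit β + 2 * E * (K * z) ≤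
                        2 * d * (K * (z * bit β)) + (d * d + E * E + K * K * (z * z))
    pointwise z false = begin
      2 * d * E * 0 + 2 * E * (K * z)
        ≡⟨ expand d E (K * z) ⟩
      2 * (E * (K * z))
        ≤⟨ 2xy≤x²+y² E (K * z) ⟩
      E * E + K * z * (K * z)
        ≤⟨ m≤n+m (E * E + K * z * (K * z)) (d * d) ⟩
      d * d + (E * E + K * z * (K * z))
        ≡⟨ collect d E K z ⟩
      2 * d * (K * (z * 0)) + (d * d + E * E + K * K * (z * z))
        ∎
      where
      open ≤-Reasoning
      expand : ∀ d E a → 2 * d * E * 0 + 2 * E * a ≡ 2 * (E * a)
      expand = solve-∀
      collect : ∀ d E K z → d * d + (E * E + K * z * (K * z)) ≡
                            2 * d * (K * (z * 0)) + (d * d + E * E + K * K * (z * z))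
      collect = solve-∀
    pointwise z true = begin
      2 * d * E * 1 + 2 * E * (K * z)
        ≡⟨ expand d E (K * z) ⟩
      2 * (E * (K * z + d))
        ≤⟨ 2xy≤x²+y² E (K * z + d) ⟩
      E * E + (K * z + d) * (K * z + d)
        ≡⟨ collect d E K z ⟩
      2 * d * (K * (z * 1)) + (d * d + E * E + K * K * (z * z))
        ∎
      where
      open ≤-Reasoning
      expand : ∀ d E a → 2 * d * E * 1 + 2 * E * a ≡ 2 * (E * (a + d))
      expand = solve-∀
      collect : ∀ d E K z → E * E + (K * z + d) * (K * z + d) ≡
                            2 * d * (K * (z * 1)) + (d * d + E * E + K * K * (z * z))
      collect = solve-∀

    summed : 2 * d * E * ∑ G (bit ∘ f) + 2 * E * (K * ∑Z n) ≤
             2 * d * (K * ∑ G (λ x → Z n x * bit (f x))) +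
               (size n * (d * d + E * E) + K * K * ∑Z² n)
    summed = begin
      2 * d * E * ∑ G (bit ∘ f) + 2 * E * (K * ∑Z n)
        ≡⟨ cong₂ _+_ (∑-* G (2 * d * E) (bit ∘ f))
             (trans (∑-* G (2 * E) (λ x → K * Z n x)) (cong (2 * E *_) (∑-* G K (Z n)))) ⟨
      ∑ G (λ x → 2 * d * E * bit (f x)) + ∑ G (λ x → 2 * E * (K * Z n x))
        ≡⟨ ∑-+ G (λ x → 2 * d * E * bit (f x)) (λ x → 2 * E * (K * Z n x)) ⟨
      ∑ G (λ x → 2 * d * E * bit (f x) + 2 * E * (K * Z n x))
        ≤⟨ ∑-mono G (λ x → pointwise (Z n x) (f x)) ⟩
      ∑ G (λ x → 2 * d * (K * (Z n x * bit (f x))) + (d * d + E * E + K * K * (Z n x * Z n x)))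
        ≡⟨ ∑-+ G (λ x → 2 * d * (K * (Z n x * bit (f x))))
                 (λ x → d * d + E * E + K * K * (Z n x * Z n x)) ⟩
      ∑ G (λ x → 2 * d * (K * (Z n x * bit (f x)))) +
        ∑ G (λ x → d * d + E * E + K * K * (Z n x * Z n x))
        ≡⟨ cong₂ _+_
             (trans (∑-* G (2 * d) (λ x → K * (Z n x * bit (f x))))
               (cong (2 * d *_) (∑-* G K (λ x → Z n x * bit (f x)))))
             (trans (∑-+ G (λ _ → d * d + E * E) (λ x → K * K * (Z n x * Z n x)))
               (cong₂ _+_ (∑-const G (d * d + E * E)) (∑-* G (K * K) (λ x → Z n x * Z n x)))) ⟩
      2 * d * (K * ∑ G (λ x → Z n x * bit (f x))) + (size n * (d * d + E * E) + K * K * ∑Z² n)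
        ∎
      where open ≤-Reasoning

    -- In `summed`, `weighted-bound` controls the sum over the set, while `mean` and `second-moment`
    -- evaluate the sums over all vertices. The terms quadratic in `E` then cancel.
    cardinality-bound : 2 * d * E * ∑ G (bit ∘ f) + size n * (n * (W * W)) ≤
                        size n * (2 * d * (n * T) + d * d + n * (K * Q))
    cardinality-bound = +-cancelʳ-≤ (2 * E * (E * size n)) _ _ (begin
      2 * d * E * ∑ G (bit ∘ f) + size n * (n * (W * W)) + 2 * E * (E * size n)
        ≡⟨ swap (2 * d * E * ∑ G (bit ∘ f)) (size n * (n * (W * W))) (2 * E * (E * size n)) ⟩
      2 * d * E * ∑ G (bit ∘ f) + 2 * E * (E * size n) + size n * (n * (W * W))
        ≡⟨ cong (λ m → 2 * d * E * ∑ G (bit ∘ f) + 2 * E * m + size n * (n * (W * W))) (mean n) ⟨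
      2 * d * E * ∑ G (bit ∘ f) + 2 * E * (K * ∑Z n) + size n * (n * (W * W))
        ≤⟨ +-monoˡ-≤ (size n * (n * (W * W))) summed ⟩
      2 * d * (K * ∑ G (λ x → Z n x * bit (f x))) +
        (size n * (d * d + E * E) + K * K * ∑Z² n) + size n * (n * (W * W))
        ≤⟨ +-monoˡ-≤ (size n * (n * (W * W))) (+-monoˡ-≤ _ (*-monoʳ-≤ (2 * d)
             (weighted-bound n f ind))) ⟩
      2 * d * (n * T * size n) +
        (size n * (d * d + E * E) + K * K * ∑Z² n) + size n * (n * (W * W))
        ≡⟨ assoc (2 * d * (n * T * size n)) (size n * (d * d + E * E)) (K * K * ∑Z² n)
             (size n * (n * (W * W))) ⟩
      2 * d * (n * T * size n) + size n * (d * d + E * E) +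
        (K * K * ∑Z² n + size n * (n * (W * W)))
        ≡⟨ cong (2 * d * (n * T * size n) + size n * (d * d + E * E) +_) (second-moment n) ⟩
      2 * d * (n * T * size n) + size n * (d * d + E * E) + size n * (E * E + n * (K * Q))
        ≡⟨ regroup n d E T (K * Q) (size n) ⟩
      size n * (2 * d * (n * T) + d * d + n * (K * Q)) + 2 * E * (E * size n)
        ∎)
      where
      open ≤-Reasoning
      swap : ∀ x y z → x + y + z ≡ x + z + y
      swap = solve-∀
      assoc : ∀ x y z w → x + (y + z) + w ≡ x + y + (z + w)
      assoc = solve-∀
      regroup : ∀ n d E T q s →
        2 * d * (n * T * s) + s * (d * d + E * E) + s * (E * E + n * q) ≡
        s * (2 * d * (n * T) + d * d + n * q) + 2 * E * (E * s)
      regroup = solve-∀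

  α-bound : ∀ n d → 2 * d * (n * W) * α (Power n) + size n * (n * (W * W)) ≤
                    size n * (2 * d * (n * T) + d * d + n * (K * Q))
  α-bound n d = let S , ind , _ = maximumIndependent (Power n) in
    subst (λ m → 2 * d * (n * W) * m + size n * (n * (W * W)) ≤
                 size n * (2 * d * (n * T) + d * d + n * (K * Q)))
      (sym (∣∣≡∑ (Power n) S))
      (cardinality-bound n d (λ v → lookup S (index (Power n) v)) λ u v u∈ v∈ →
        ind u v (lookup⇒[]= _ S u∈) (lookup⇒[]= _ S v∈))

  -- The factor `size n` cancels from `α-bound`, which leaves a condition on plain numbers. One good
  -- `n` suffices, since `Above` for the limit asks for a single ratio below the given rational;
  -- index `n * 3` belongs to the power `1 + n * 3`.
  ratio-bound : ∀ n d p q .{{_ : NonZero q}} .{{_ : NonZero (2 * d * (n * W))}} →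
                q * (2 * d * (n * T) + d * d + n * (K * Q)) ≤
                  p * (2 * d * (n * W)) + q * (n * (W * W)) →
                ratio W₅ (n * 3) ℚ.≤ ℤ.+ p ℚ./ q
  ratio-bound n d p q numeric =
    /-mono (α (Power n)) (size n) p q {{^□-nonZero W₅ (suc (n * 3))}}
      (*-cancelˡ-≤ c (+-cancelʳ-≤ (q * (size n * v)) _ _ (begin
        c * (α (Power n) * q) + q * (size n * v)  ≡⟨ collect c (α (Power n)) q (size n) v ⟩
        q * (c * α (Power n) + size n * v)        ≤⟨ *-monoʳ-≤ q (α-bound n d) ⟩
        q * (size n * e)                          ≡⟨ swap q (size n) e ⟩
        size n * (q * e)                          ≤⟨ *-monoʳ-≤ (size n) numeric ⟩
        size n * (p * c + q * v)                  ≡⟨ expand (size n) p c q v ⟩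
        c * (p * size n) + q * (size n * v)       ∎)))
    where
    open ≤-Reasoning
    c e v : ℕ
    c = 2 * d * (n * W)
    e = 2 * d * (n * T) + d * d + n * (K * Q)
    v = n * (W * W)

    collect : ∀ c a q s v → c * (a * q) + q * (s * v) ≡ q * (c * a + s * v)
    collect = solve-∀
    swap : ∀ q s e → q * (s * e) ≡ s * (q * e)
    swap = solve-∀
    expand : ∀ s p c q v → s * (p * c + q * v) ≡ c * (p * s) + q * (s * v)
    expand = solve-∀

-- A sufficiently high power

open import Data.Integer.Base using (+_)
open import Data.Rational.Base using (_/_)

-- With n = 300000 and d = 100000 the error d / (2 * 1444 n) + (216 * 9886 ∸ 1444²) / (2 * 1444 d)
-- is below 1019 / 3888 ∸ 378 / 1444.
theorem1p7 : 𝓘 W₅ ≤ℝ fromℚ (+ 1019 / 3888)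
theorem1p7 q p<q =
  300000 * 3 , ℚ.≤-<-trans (ratio-bound 300000 100000 1019 3888 (≤ᵇ⇒≤ _ _ tt)) p<q
  where open Moments 216 1444 9886 378 refl ∑ω ∑ω² size-suc cube-bound
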